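{- Let $(G,F)$ be a framed graph and $C,C'$ maximal cliques. Then $C\le C'$ in the framing poset $\mathscr L_{G,F}$ if and only if $C$ is cw from $C'$, i.e. for all routes $R\in C$, $R'\in C'$ and every common inner vertex $v$ of $R$ and $R'$, either $R$ and $R'$ are coherent at $v$ or $R<_v^{cw}R'$.
   Context: A flow graph $G$ is a finite directed acyclic multigraph with linearly ordered vertices, edges directed from smaller to larger vertices, a unique source $s$ and unique sink $t$; a route is a directed $s$–$t$ path. A framing $F$ gives at each vertex $v$ linear orders $\le_{\mathrm{In}(v)}$, $\le_{\mathrm{Out}(v)}$ on entering and leaving edges. For a path $P$ through $v$, $Pv$ (resp. $vP$) is the maximal subpath of $P$ ending (resp. starting) at $v$. For $Pv,Qv$, let $w$ be the first vertex after which they coincide; if $w$ is the first vertex of one of them they are equal, else $Pv<_{\mathscr I(v)}Qv$ iff $P$'s edge entering $w$ precedes $Q$'s in $\le_{\mathrm{In}(w)}$. Dually for $vP,vQ$ with $w'$ the last vertex before which they coincide, using $\le_{\mathrm{Out}(w')}$, giving $<_{\mathscr O(v)}$. For paths $P,Q$ with common inner vertex $v$ (neither first nor last vertex), $P<_v^{cw}Q$ means $Pv<_{\mathscr I(v)}Qv$ and $vQ<_{\mathscr O(v)}vP$; they are incoherent at $v$ if $P<_v^{cw}Q$ or $Q<_v^{cw}P$, coherent if incoherent at no common inner vertex. A clique is a set of pairwise coherent routes. For maximal cliques, $C\lessdot C'$ if $C'=(C\setminus\{R\})\cup\{R'\}$ with $R<_u^{cw}R'$ for some $u$; the framing poset $\mathscr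 L_{G,F}$ is the set of maximal cliques ordered by the reflexive-transitive closure $\le$ of $\lessdot$. -}

module Defs where

open import Level using (0ℓ)
open import Data.Nat using (ℕ)
open import Data.Fin using (Fin; _<_; _≟_)
open import Data.List using (List; []; _∷_; _++_; reverse)
open import Data.List.Membership.Propositional using (_∈_)
open import Data.List.Relation.Unary.All using (All)
open import Data.Product using (Σ; ∃; _×_; proj₁)
open import Data.Sum using (_⊎_)
open import Data.Empty using (⊥)
open import Relation.Nullary using (¬_; yes; no)
open import Relation.Binary.Core using (Rel)
open import Relation.Binary.Structures using (IsStrictTotalOrder)
open import Relation.Binary.PropositionalEquality using (_≡_; _≢_)
open import Function.Bundles using (_⇔_)

-- Flow graphs: vertices Fin n (ordered by the order of Fin), edges Fin m
-- (a multigraph: distinct edges may share endpoints), every edge goes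
-- from a smaller to a larger vertex (hence acyclic), unique source s and
-- unique sink t.

record FlowGraph : Set where
  field
    n m      : ℕ
    tail     : Fin m → Fin n
    head     : Fin m → Fin n
    tail<head : ∀ e → tail e < head e
    s t      : Fin n
    s-source : ∀ e → head e ≢ s
    t-sink   : ∀ e → tail e ≢ t
    s-unique : ∀ v → v ≢ s → ∃ λ e → head e ≡ v
    t-unique : ∀ v → v ≢ t → ∃ λ e → tail e ≡ v

open FlowGraph public

Vtx : FlowGraph → Set
Vtx G = Fin (n G)

Edge : FlowGraph → Set
Edge G = Fin (m G)

In : (G : FlowGraph) → Vtx G → Set
In G v = Σ (Edge G) λ e → head G e ≡ v

Out : (G : FlowGraph) → Vtx G → Set
Out G v = Σ (Edge G) λ e → tail G e ≡ v

-- A framing: at each vertex v a (strict) linear order on In(v) and on Out(v).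
-- The relations are given on all edges, but only their restriction to
-- In(v) (resp. Out(v)) is required to be a strict total order, and only
-- that restriction is ever used.
record Framing (G : FlowGraph) : Set₁ where
  field
    inLt   : Vtx G → Rel (Edge G) 0ℓ
    outLt  : Vtx G → Rel (Edge G) 0ℓ
    inSTO  : ∀ v → IsStrictTotalOrder {A = In G v}
                     (λ x y → proj₁ x ≡ proj₁ y)
                     (λ x y → inLt v (proj₁ x) (proj₁ y))
    outSTO : ∀ v → IsStrictTotalOrder {A = Out G v}
                     (λ x y → proj₁ x ≡ proj₁ y)
                     (λ x y → outLt v (proj₁ x) (proj₁ y))

open Framing public

module _ (G : FlowGraph) where

  data IsPath : Vtx G → List (Edge G) → Vtx G → Set where
    nil  : ∀ {u} → IsPath u [] u
    cons : ∀ {u e es w} → tail G e ≡ u → IsPath (head G e) es w → IsPath u (e ∷ es) w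

  Route : Set
  Route = List (Edge G)

  IsRoute : Route → Set
  IsRoute P = IsPath (s G) P (t G)

  -- v is an inner vertex of P, witnessed by the split
  -- P = (pre ++ [a]) ++ (b ∷ post) with head a = v;
  -- then Pv = pre ++ [a] and vP = b ∷ post.
  record InnerAt (P : List (Edge G)) (v : Vtx G) : Set where
    constructor split
    field
      pre post : List (Edge G)
      a b      : Edge G
      eq       : P ≡ (pre ++ a ∷ []) ++ (b ∷ post)
      hd       : head G a ≡ v

  upTo : ∀ {P v} → InnerAt P v → List (Edge G)
  upTo sp = InnerAt.pre sp ++ InnerAt.a sp ∷ []

  from : ∀ {P v} → InnerAt P v → List (Edge G)
  from sp = InnerAt.b sp ∷ InnerAt.post sp

module _ (G : FlowGraph) (F : Framing G) where

  -- Order <_I(v) on paths ending at v, applied to the REVERSED edge lists: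
  -- walk back along the common suffix; at the first pair of differing edges
  -- a ≠ b (both entering w = head a) compare them in ≤_In(w).  If one path
  -- is exhausted first (w is its first vertex) they are not strictly related.
  revLtIn : List (Edge G) → List (Edge G) → Set
  revLtIn [] _ = ⊥
  revLtIn (_ ∷ _) [] = ⊥
  revLtIn (a ∷ p) (b ∷ q) with a ≟ b
  ... | yes _ = revLtIn p q
  ... | no  _ = inLt F (head G a) a b

  ltI : List (Edge G) → List (Edge G) → Set
  ltI P Q = revLtIn (reverse P) (reverse Q)

  -- Order <_O(v) on paths starting at v: first differing edges a ≠ b
  -- (both leaving w' = tail a) compared in ≤_Out(w').
  ltO : List (Edge G) → List (Edge G) → Set
  ltO [] _ = ⊥
  ltO (_ ∷ _) [] = ⊥
  ltO (a ∷ p) (b ∷ q) with a ≟ b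
  ... | yes _ = ltO p q
  ... | no  _ = outLt F (tail G a) a b

  CW : List (Edge G) → Vtx G → List (Edge G) → Set
  CW P v Q = Σ (InnerAt G P v) λ sp → Σ (InnerAt G Q v) λ sq →
               ltI (upTo G sp) (upTo G sq) × ltO (from G sq) (from G sp)

  CoherentAt : Vtx G → List (Edge G) → List (Edge G) → Set
  CoherentAt v P Q = ¬ CW P v Q × ¬ CW Q v P

  Coherent : List (Edge G) → List (Edge G) → Set
  Coherent P Q = ∀ v → CoherentAt v P Q

  -- Sets of routes are represented by lists (with set semantics).
  _⊆_ : List (Route G) → List (Route G) → Set
  C ⊆ D = ∀ {R} → R ∈ C → R ∈ D

  IsClique : List (Route G) → Set
  IsClique C = All (IsRoute G) C × (∀ {P Q} → P ∈ C → Q ∈ C → Coherent P Q)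

  MaxClique : List (Route G) → Set
  MaxClique C = IsClique C × (∀ D → IsClique D → C ⊆ D → D ⊆ C)

  Cover : List (Route G) → List (Route G) → Set
  Cover C C' = Σ (Route G) λ R → Σ (Route G) λ R' → Σ (Vtx G) λ u →
                 R ∈ C × IsRoute G R' × CW R u R' ×
                 (∀ X → X ∈ C' ⇔ ((X ∈ C × X ≢ R) ⊎ X ≡ R'))

  _≐_ : List (Route G) → List (Route G) → Set
  C ≐ D = C ⊆ D × D ⊆ C

  -- reflexive-transitive closure of ⋖ on the set of maximal cliques
  -- (cliques are sets, so reflexivity is up to set equality ≐)
  data _≤L_ : List (Route G) → List (Route G) → Set where
    ≤-refl : ∀ {C C'} → C ≐ C' → C ≤L C'
    ≤-step : ∀ {C D E} → Cover C D → MaxClique D → D ≤L E → C ≤L E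

  CwFrom : List (Route G) → List (Route G) → Set
  CwFrom C C' = ∀ {R R'} → R ∈ C → R' ∈ C' → ∀ v →
                  InnerAt G R v → InnerAt G R' v →
                  CoherentAt v R R' ⊎ CW R v R'

{-# OPTIONS --safe #-}
module Submission where

-- At a vertex w, coherence makes the pairs (Rw, wR) of a clique a chain in the product order,
-- and maximality makes it saturated: consecutive pairs differ in one coordinate.  Replacing
-- the middle of a corner (p , q), (p , q′), (p′ , q′) by (p′ , q) is a cover.
-- In a cover exchanging R for R′ at u, the resolvents RuR′ and R′uR lie in both cliques, and every
-- route that is cw below R is cw below one of them or R′; hence ≤ implies cw.  Conversely, if
-- C is cw from C′ and C ⊈ C′, look at the first vertex where a prefix of a route of C is not a
-- prefix of a route of C′.  A corner of C there can be flipped so that the result is still cw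
-- from C′, and a flip shrinks the finite set of routes lying cw above a member of C.

open import Defs
open import Level using (0ℓ)
open import Data.Empty using (⊥; ⊥-elim)
open import Data.Fin as Fin using (Fin; toℕ)
import Data.Fin.Properties as Fin
open import Data.List using (List; []; _∷_; _++_; _ʳ++_; reverse; length; concatMap; filter; allFin; cartesianProductWith)
open import Data.List.Properties using (≡-dec; ++-ʳ++; ʳ++-defn; unfold-reverse; reverse-involutive; reverse-++; ++-assoc)
open import Data.List.Membership.Propositional using (_∈_; find; lose)
open import Data.List.Membership.Propositional.Properties using (∈-concatMap⁺; ∈-concatMap⁻; ∈-filter⁺; ∈-filter⁻; ∈-allFin; ∈-cartesianProductWith⁺)
open import Data.List.Relation.Unary.All as All using (All; []; _∷_)
open import Data.List.Relation.Unary.Any as Any using (Any; here; there; any?)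
open import Data.Nat as ℕ using (ℕ; zero; suc; z≤n; s≤s)
import Data.Nat.Properties as ℕ
open import Data.Nat.Induction using (<-wellFounded)
open import Data.Fin.Induction using (>-wellFounded) renaming (<-wellFounded to <-wellFoundedᶠ)
open import Data.Unit using (⊤; tt)
open import Data.Product using (∃; ∃₂; _×_; _,_; proj₁; proj₂)
open import Data.Sum using (_⊎_; inj₁; inj₂; [_,_])
open import Function using (_∘_; flip; case_of_)
open import Function.Bundles using (_⇔_; mk⇔; Equivalence)
open import Induction.WellFounded using (Acc; acc)
open import Relation.Binary.Core using (Rel)
open import Relation.Binary.Definitions using (Transitive; tri<; tri≈; tri>)
open import Relation.Binary.Structures using (IsStrictTotalOrder)
open import Relation.Binary.PropositionalEquality using (_≡_; _≢_; refl; sym; trans; cong; subst; subst₂)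
open import Relation.Nullary using (¬_; Dec; yes; no; contradiction)
open import Relation.Nullary.Decidable using (map′; _×-dec_; _⊎-dec_; ¬?; decidable-stable)
open import Relation.Unary using (Decidable)

-- Two routes can be incoherent in opposite directions at different vertices, so `≺` is no order on
-- routes and cannot be composed. What replaces transitivity is a trichotomy (`locate`): seen from a
-- vertex `w`, a clash of `p ʳ++ q` with `X` is decided by `p` before `w`, or by `q` after `w`, or
-- takes place at `w`. A clash of the first two kinds survives when the other half is exchanged, so
-- a spliced route inherits it from one of the routes that it is spliced from; only the comparison
-- of pairs at `w` is left. To compare `C` with `C′` one must know that an edge leaving the prefixes
-- of `C′` still occurs somewhere in `C′`. Hence the detour showing that a maximal clique uses every
-- edge; it also forces the prefixes of the two cliques to agree up to the vertex where the corner
-- is taken.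

-- Lexicographic orders on words and search in finite lists

module _ {A : Set} where

  -- A word never precedes a proper extension of itself.
  data Lex (R : Rel A 0ℓ) : Rel (List A) 0ℓ where
    this : ∀ {a b p q} → R a b → Lex R (a ∷ p) (b ∷ q)
    next : ∀ {a p q} → Lex R p q → Lex R (a ∷ p) (a ∷ q)

  module _ {R : Rel A 0ℓ} where

    lex-irrefl : (∀ {a} → ¬ R a a) → ∀ {p} → ¬ Lex R p p
    lex-irrefl irr (this r) = irr r
    lex-irrefl irr (next l) = lex-irrefl irr l

    lex-trans : Transitive R → Transitive (Lex R)
    lex-trans tr (this r) (this r′) = this (tr r r′)
    lex-trans tr (this r) (next l) = this r
    lex-trans tr (next l) (this r) = this r
    lex-trans tr (next l) (next l′) = next (lex-trans tr l l′)

    lex-flip : ∀ {p q} → Lex R p q → Lex (flip R) q p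
    lex-flip (this r) = this r
    lex-flip (next l) = next (lex-flip l)

    lex-++ : ∀ r {p q} → Lex R p q → Lex R (r ++ p) (r ++ q)
    lex-++ [] l = l
    lex-++ (_ ∷ r) l = next (lex-++ r l)

    lex-ʳ++ : ∀ r {p q} → Lex R p q → Lex R (r ʳ++ p) (r ʳ++ q)
    lex-ʳ++ [] l = l
    lex-ʳ++ (_ ∷ r) l = lex-ʳ++ r (next l)

    -- The first difference lies beyond `r` or inside it; if inside, whatever follows `r` may be
    -- replaced. This is the source of the trichotomy for clashes.
    lex-++⁻ : ∀ r {p x} → Lex R (r ++ p) x →
              (∃ λ x′ → x ≡ r ++ x′ × Lex R p x′) ⊎ (∀ p₀ → Lex R (r ++ p₀) x)
    lex-++⁻ [] l = inj₁ (_ , refl , l)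
    lex-++⁻ (_ ∷ r) (this e) = inj₂ λ _ → this e
    lex-++⁻ (_ ∷ r) (next l) with lex-++⁻ r l
    ... | inj₁ (x′ , refl , l′) = inj₁ (x′ , refl , l′)
    ... | inj₂ h = inj₂ λ p₀ → next (h p₀)

    lex-ʳ++⁻ : ∀ r {q z} → Lex R z (r ʳ++ q) →
               (∃ λ z′ → z ≡ r ʳ++ z′ × Lex R z′ q) ⊎ (∀ q₀ → Lex R z (r ʳ++ q₀))
    lex-ʳ++⁻ [] l = inj₁ (_ , refl , l)
    lex-ʳ++⁻ (e ∷ r) l with lex-ʳ++⁻ r l
    ... | inj₂ h = inj₂ λ q₀ → h (e ∷ q₀)
    ... | inj₁ (_ , refl , this x) = inj₂ λ q₀ → lex-ʳ++ r (this x)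
    ... | inj₁ (_ , refl , next l′) = inj₁ (_ , refl , l′)

    lex-between : (∀ {a} → ¬ R a a) → Transitive R → ∀ r {p q x} → Lex R (r ++ p) x → Lex R x (r ++ q) →
                  ∃ λ x′ → x ≡ r ++ x′ × Lex R p x′ × Lex R x′ q
    lex-between irr tr [] l m = _ , refl , l , m
    lex-between irr tr (_ ∷ r) (this e) (this e′) = ⊥-elim (irr (tr e e′))
    lex-between irr tr (_ ∷ r) (this e) (next _) = ⊥-elim (irr e)
    lex-between irr tr (_ ∷ r) (next _) (this e) = ⊥-elim (irr e)
    lex-between irr tr (_ ∷ r) (next l) (next m) with lex-between irr tr r l m
    ... | x′ , refl , l′ , m′ = x′ , refl , l′ , m′

    lex-common : ∀ {p q} → Lex R p q →
                 ∃ λ r → ∃₂ λ a p′ → ∃₂ λ b q′ → p ≡ r ʳ++ (a ∷ p′) × q ≡ r ʳ++ (b ∷ q′) × R a b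
    lex-common l = go [] l
      where
      go : ∀ r {p q} → Lex R p q →
           ∃ λ r′ → ∃₂ λ a p′ → ∃₂ λ b q′ →
             r ʳ++ p ≡ r′ ʳ++ (a ∷ p′) × r ʳ++ q ≡ r′ ʳ++ (b ∷ q′) × R a b
      go r (this x) = r , _ , _ , _ , _ , refl , refl , x
      go r (next {a} l) = go (a ∷ r) l

    ¬lex-[] : ∀ r {b z} → [] ≡ r ʳ++ b → ¬ Lex R z b
    ¬lex-[] [] refl ()
    ¬lex-[] (e ∷ r) {b} eq _ = nonempty r eq
      where
      nonempty : ∀ r {e b} → [] ≢ r ʳ++ (e ∷ b)
      nonempty [] ()
      nonempty (_ ∷ r) = nonempty r

    lex-dec : (∀ a b → Dec (a ≡ b)) → (∀ a b → Dec (R a b)) → ∀ p q → Dec (Lex R p q)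
    lex-dec eq? r? [] q = no λ ()
    lex-dec eq? r? (a ∷ p) [] = no λ ()
    lex-dec eq? r? (a ∷ p) (b ∷ q) with r? a b
    ... | yes r = yes (this r)
    ... | no ¬r with eq? a b
    ...   | no a≢b = no λ { (this r) → ¬r r ; (next _) → a≢b refl }
    ...   | yes refl = map′ next (λ { (this r) → contradiction r ¬r ; (next l) → l }) (lex-dec eq? r? p q)

  -- The recursion pulls the second cut back by one letter. If the cuts then coincide, that is `r`
  -- is empty, the answer changes side; otherwise the last letter of `r` is given back.
  ʳ++-overlap : ∀ (p q a b : List A) → p ʳ++ q ≡ a ʳ++ b →
                (∃ λ r → p ≡ r ++ a × b ≡ r ʳ++ q) ⊎ (∃ λ r → a ≡ r ++ p × q ≡ r ʳ++ b)
  ʳ++-overlap p q [] b refl = inj₁ (p , sym (++-[] p) , refl)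
    where
    ++-[] : ∀ xs → xs ++ [] ≡ xs
    ++-[] [] = refl
    ++-[] (x ∷ xs) = cong (x ∷_) (++-[] xs)
  ʳ++-overlap p q (e ∷ a) b eq with ʳ++-overlap p q a (e ∷ b) eq
  ... | inj₂ (r , refl , eq′) = inj₂ (e ∷ r , refl , eq′)
  ... | inj₁ (r , eq₁ , eq₂) with snoc r eq₁ eq₂
    where
    snoc : ∀ r → p ≡ r ++ a → e ∷ b ≡ r ʳ++ q →
           (r ≡ []) ⊎ (∃ λ r′ → p ≡ r′ ++ e ∷ a × b ≡ r′ ʳ++ q)
    snoc [] _ _ = inj₁ refl
    snoc (f ∷ r) h h′ = inj₂ (last f r h h′)
      where
      open import Data.List using (initLast; _∷ʳ′_)
      last : ∀ f r → p ≡ f ∷ r ++ a → e ∷ b ≡ r ʳ++ (f ∷ q) → ∃ λ r′ → p ≡ r′ ++ e ∷ a × b ≡ r′ ʳ++ q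
      last f r h h′ with initLast r
      last f .[] refl refl | [] = [] , refl , refl
      last f .(r′ ++ g ∷ []) refl h′ | r′ ∷ʳ′ g with trans h′ (++-ʳ++ r′)
      ... | refl = f ∷ r′ , cong (f ∷_) (++-assoc r′ _ a) , refl
  ... | inj₁ refl = inj₂ (e ∷ [] , cong (e ∷_) (sym eq₁) , sym eq₂)
  ... | inj₂ h = inj₁ h

  module _ {_⊏_ : Rel A 0ℓ} (_⊏?_ : ∀ x y → Dec (x ⊏ y)) (⊏-trans : Transitive _⊏_) (⊏-irrefl : ∀ {x} → ¬ x ⊏ x) {P : A → Set} (P? : Decidable P) where

    abstract
      extremal : ∀ xs {x} → x ∈ xs → P x → ∃ λ m → m ∈ xs × P m × (∀ {y} → y ∈ xs → P y → ¬ m ⊏ y)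
      extremal xs x∈ px with best xs _ px
        where
        best : ∀ xs m → P m → ∃ λ m′ → (m′ ≡ m ⊎ m′ ∈ xs) × P m′ × ¬ m′ ⊏ m × (∀ {y} → y ∈ xs → P y → ¬ m′ ⊏ y)
        best [] m pm = m , inj₁ refl , pm , ⊏-irrefl , λ ()
        best (x ∷ xs) m pm with best xs m pm
        ... | m′ , in′ , pm′ , ≮m , ≮xs with P? x | m′ ⊏? x
        ...   | yes px | yes m′⊏x = x , inj₂ (here refl) , px , (λ l → ≮m (⊏-trans m′⊏x l)) ,
                  λ { (here refl) _ → ⊏-irrefl ; (there y∈) py l → ≮xs y∈ py (⊏-trans m′⊏x l) }
        ...   | yes _ | no ≮x = m′ , [ inj₁ , inj₂ ∘ there ] in′ , pm′ , ≮m ,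
                  λ { (here refl) _ → ≮x ; (there y∈) py → ≮xs y∈ py }
        ...   | no ¬px | _ = m′ , [ inj₁ , inj₂ ∘ there ] in′ , pm′ , ≮m ,
                  λ { (here refl) py → contradiction py ¬px ; (there y∈) py → ≮xs y∈ py }
      ... | m , inj₁ refl , pm , _ , ≮ = m , x∈ , pm , ≮
      ... | m , inj₂ m∈ , pm , _ , ≮ = m , m∈ , pm , ≮

  length-filter-mono : ∀ {P Q : A → Set} (P? : Decidable P) (Q? : Decidable Q) → (∀ {x} → P x → Q x) →
                       ∀ xs → length (filter P? xs) ℕ.≤ length (filter Q? xs)
  length-filter-mono P? Q? P⇒Q [] = z≤n
  length-filter-mono P? Q? P⇒Q (x ∷ xs) with P? x | Q? x
  ... | yes p | yes q = s≤s (length-filter-mono P? Q? P⇒Q xs)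
  ... | yes p | no ¬q = contradiction (P⇒Q p) ¬q
  ... | no _ | yes _ = ℕ.m≤n⇒m≤1+n (length-filter-mono P? Q? P⇒Q xs)
  ... | no _ | no _ = length-filter-mono P? Q? P⇒Q xs

  length-filter-< : ∀ {P Q : A → Set} (P? : Decidable P) (Q? : Decidable Q) → (∀ {x} → P x → Q x) →
                    ∀ {xs x} → x ∈ xs → Q x → ¬ P x → length (filter P? xs) ℕ.< length (filter Q? xs)
  length-filter-< P? Q? P⇒Q {xs = x ∷ xs} x∈ qx ¬px with P? x | Q? x | x∈
  ... | yes p | _ | here refl = contradiction p ¬px
  ... | no _ | no ¬q | here refl = contradiction qx ¬q
  ... | no _ | yes _ | here refl = s≤s (length-filter-mono P? Q? P⇒Q xs)
  ... | yes _ | yes _ | there x∈′ = s≤s (length-filter-< P? Q? P⇒Q x∈′ qx ¬px)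
  ... | yes p | no ¬q | there x∈′ = contradiction (P⇒Q p) ¬q
  ... | no _ | yes _ | there x∈′ = ℕ.m≤n⇒m≤1+n (length-filter-< P? Q? P⇒Q x∈′ qx ¬px)
  ... | no _ | no _ | there x∈′ = length-filter-< P? Q? P⇒Q x∈′ qx ¬px

  words : List A → ℕ → List (List A)
  words as zero = [] ∷ []
  words as (suc k) = [] ∷ cartesianProductWith _∷_ as (words as k)

  ∈-words : ∀ {as} → (∀ a → a ∈ as) → ∀ w {k} → length w ℕ.≤ k → w ∈ words as k
  ∈-words full [] {zero} _ = here refl
  ∈-words full [] {suc k} _ = here refl
  ∈-words full (a ∷ w) (s≤s l) = there (∈-cartesianProductWith⁺ _∷_ (full a) (∈-words full w l))

  splits : List A → List A → List (List A × List A)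
  splits p [] = (p , []) ∷ []
  splits p (e ∷ q) = (p , e ∷ q) ∷ splits (e ∷ p) q

  ∈-splits⁻ : ∀ a b {p q} → (p , q) ∈ splits a b → p ʳ++ q ≡ a ʳ++ b
  ∈-splits⁻ a [] (here refl) = refl
  ∈-splits⁻ a (e ∷ b) (here refl) = refl
  ∈-splits⁻ a (e ∷ b) (there i) = ∈-splits⁻ (e ∷ a) b i

  ∈-splits⁺ : ∀ p q → (p , q) ∈ splits [] (p ʳ++ q)
  ∈-splits⁺ [] [] = here refl
  ∈-splits⁺ [] (e ∷ q) = here refl
  ∈-splits⁺ (e ∷ p) q = shift [] _ (∈-splits⁺ p (e ∷ q))
    where
    first : ∀ a b → (a , b) ∈ splits a b
    first a [] = here refl
    first a (_ ∷ _) = here refl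
    shift : ∀ a b {p e q} → (p , e ∷ q) ∈ splits a b → (e ∷ p , q) ∈ splits a b
    shift a [] (here ())
    shift a (f ∷ b) (here refl) = there (first (f ∷ a) b)
    shift a (f ∷ b) (there i) = there (shift (f ∷ a) b i)

-- Directed paths and their cuts at a vertex

module Paths (G : FlowGraph) where

  private
    E = Edge G
    V = Vtx G

  -- a directed path from u to v, listed from its last edge to its first
  data Seg (u : V) : List E → V → Set where
    nil  : Seg u [] u
    snoc : ∀ {e p v w} → Seg u p v → tail G e ≡ v → head G e ≡ w → Seg u (e ∷ p) w

  Back Fwd : V → List E → Set
  Back v p = Seg (s G) p v
  Fwd v q = IsPath G v q (t G)

  seg-++ : ∀ {u v w a} r → Seg v r w → Seg u a v → Seg u (r ++ a) w
  seg-++ [] nil σ = σ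
  seg-++ (_ ∷ r) (snoc τ h h′) σ = snoc (seg-++ r τ σ) h h′

  seg-++⁻ : ∀ {u w a} r → Seg u (r ++ a) w → ∃ λ v → Seg v r w × Seg u a v
  seg-++⁻ [] σ = _ , nil , σ
  seg-++⁻ (_ ∷ r) (snoc σ h h′) with seg-++⁻ r σ
  ... | v , τ , σ′ = v , snoc τ h h′ , σ′

  seg-end : ∀ {u v w a} → Seg u a w → Seg u a v → w ≡ v
  seg-end nil nil = refl
  seg-end (snoc _ _ h) (snoc _ _ h′) = trans (sym h) h′

  seg-suffix : ∀ {u v w a} r → Seg u (r ++ a) w → Seg u a v → Seg v r w
  seg-suffix r σ τ with seg-++⁻ r σ
  ... | v , ρ , τ′ with seg-end τ′ τ
  ... | refl = ρ

  seg-path : ∀ {u v w q} r → Seg u r v → IsPath G v q w → IsPath G u (r ʳ++ q) w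
  seg-path [] nil π = π
  seg-path (_ ∷ r) (snoc σ h refl) π = seg-path r σ (cons h π)

  path-split : ∀ {u w q} r → IsPath G u (r ʳ++ q) w → ∃ λ v → Seg u r v × IsPath G v q w
  path-split [] π = _ , nil , π
  path-split (_ ∷ r) π with path-split r π
  ... | v , σ , cons h π′ = _ , snoc σ h refl , π′

  path-suffix : ∀ {u v w q} r → IsPath G u (r ʳ++ q) w → Seg u r v → IsPath G v q w
  path-suffix r π σ with path-split r π
  ... | v , σ′ , π′ with seg-end σ′ σ
  ... | refl = π′

  seg-< : ∀ {u v} r → Seg u r v → r ≡ [] ⊎ u Fin.< v
  seg-< [] _ = inj₁ refl
  seg-< (e ∷ r) (snoc σ refl refl) with seg-< r σ
  seg-< (e ∷ .[]) (snoc nil refl refl) | inj₁ refl = inj₂ (tail<head G e)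
  ... | inj₂ l = inj₂ (Fin.<-trans l (tail<head G e))

  seg-loop : ∀ {u} r → Seg u r u → r ≡ []
  seg-loop r σ with seg-< r σ
  ... | inj₁ eq = eq
  ... | inj₂ l = ⊥-elim (Fin.<-irrefl refl l)

  -- Vertex numbers grow along every edge. The bound places all routes in a finite list of words,
  -- over which `height` counts.
  path-length : ∀ {u w p} → IsPath G u p w → toℕ u ℕ.+ length p ℕ.≤ toℕ w
  path-length {u} nil = ℕ.≤-reflexive (ℕ.+-identityʳ (toℕ u))
  path-length {p = e ∷ p} (cons refl π) =
    ℕ.≤-trans (ℕ.≤-reflexive (ℕ.+-suc _ (length p)))
      (ℕ.≤-trans (ℕ.+-monoˡ-≤ (length p) (tail<head G e)) (path-length π))

  back-source : ∀ {p} → Back (s G) p → p ≡ []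
  back-source nil = refl
  back-source (snoc {e} _ _ h) = ⊥-elim (s-source G e h)

  fwd-sink : ∀ {q} → Fwd (t G) q → q ≡ []
  fwd-sink nil = refl
  fwd-sink (cons {e = e} h _) = ⊥-elim (t-sink G e h)

  -- The stretch between two cuts at `v` is a closed segment, hence empty by acyclicity.
  split-unique : ∀ {v p q x z} → Back v p → Back v x → p ʳ++ q ≡ x ʳ++ z → p ≡ x × q ≡ z
  split-unique {p = p} {q} {x} {z} bp bx eq with ʳ++-overlap p q x z eq
  ... | inj₁ (r , refl , refl) with seg-loop r (seg-suffix r bp bx)
  ...   | refl = refl , refl
  split-unique {p = p} {q} {x} {z} bp bx eq | inj₂ (r , refl , refl) with seg-loop r (seg-suffix r bx bp)
  ...   | refl = refl , refl

  seg? : ∀ u p v → Dec (Seg u p v)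
  seg? u [] v with u Fin.≟ v
  ... | yes refl = yes nil
  ... | no u≢v = no λ { nil → u≢v refl }
  seg? u (e ∷ p) v with head G e Fin.≟ v
  ... | no h = no λ { (snoc _ _ h′) → h h′ }
  ... | yes h = map′ (λ σ → snoc σ refl h) (λ { (snoc σ refl _) → σ }) (seg? u p (tail G e))

  path? : ∀ u q w → Dec (IsPath G u q w)
  path? u [] w with u Fin.≟ w
  ... | yes refl = yes nil
  ... | no u≢w = no λ { nil → u≢w refl }
  path? u (e ∷ q) w with tail G e Fin.≟ u
  ... | no h = no λ { (cons h′ _) → h h′ }
  ... | yes h = map′ (cons h) (λ { (cons _ π) → π }) (path? (head G e) q w)

  infix 4 _≟ₗ_

  _≟ₗ_ : (p q : List E) → Dec (p ≡ q)
  _≟ₗ_ = ≡-dec Fin._≟_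

  open import Data.List.Membership.DecPropositional _≟ₗ_ public using (_∈?_)

  -- Incoherence and where it is decided

  record Orders : Set₁ where
    field
      RI RO : Rel E 0ℓ
      RI-irrefl : ∀ {a} → ¬ RI a a
      RO-irrefl : ∀ {a} → ¬ RO a a
      RI-trans : Transitive RI
      RO-trans : Transitive RO
      RI-cmp : ∀ {a b} → head G a ≡ head G b → RI a b ⊎ a ≡ b ⊎ RI b a
      RO-cmp : ∀ {a b} → tail G a ≡ tail G b → RO a b ⊎ a ≡ b ⊎ RO b a
      RI? : ∀ a b → Dec (RI a b)
      RO? : ∀ a b → Dec (RO a b)

  -- Reversing both orders exchanges the two directions of incoherence, so that
  -- every lemma comes with its mirror image.
  op : Orders → Orders
  op O = record
    { RI = flip RI ; RO = flip RO
    ; RI-irrefl = RI-irrefl ; RO-irrefl = RO-irrefl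
    ; RI-trans = flip RI-trans ; RO-trans = flip RO-trans
    ; RI-cmp = λ h → turn (RI-cmp h) ; RO-cmp = λ h → turn (RO-cmp h)
    ; RI? = flip RI? ; RO? = flip RO?
    }
    where
    open Orders O
    turn : ∀ {A B C : Set} → A ⊎ B ⊎ C → C ⊎ B ⊎ A
    turn (inj₁ x) = inj₂ (inj₂ x)
    turn (inj₂ (inj₁ x)) = inj₂ (inj₁ x)
    turn (inj₂ (inj₂ x)) = inj₁ x

  module Base (O : Orders) where
    open Orders O public

    infix 4 _<ᵢ_ _<ₒ_ _≺_ _<ᵢ?_ _<ₒ?_ _≺?_

    _<ᵢ_ _<ₒ_ : Rel (List E) 0ℓ
    _<ᵢ_ = Lex RI
    _<ₒ_ = Lex RO

    irrᵢ : ∀ {p} → ¬ p <ᵢ p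
    irrᵢ = lex-irrefl RI-irrefl

    irrₒ : ∀ {p} → ¬ p <ₒ p
    irrₒ = lex-irrefl RO-irrefl

    transᵢ : Transitive _<ᵢ_
    transᵢ = lex-trans RI-trans

    transₒ : Transitive _<ₒ_
    transₒ = lex-trans RO-trans

    _<ᵢ?_ : ∀ p q → Dec (p <ᵢ q)
    _<ᵢ?_ = lex-dec Fin._≟_ RI?

    _<ₒ?_ : ∀ p q → Dec (p <ₒ q)
    _<ₒ?_ = lex-dec Fin._≟_ RO?

    -- Both paths start at the source, which no edge enters, so neither list is a proper prefix of
    -- the other and `Lex` is total here.
    cmpᵢ : ∀ {v p x} → Back v p → Back v x → p <ᵢ x ⊎ p ≡ x ⊎ x <ᵢ p
    cmpᵢ nil bx = inj₂ (inj₁ (sym (back-source bx)))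
    cmpᵢ bp@(snoc _ _ _) nil = inj₂ (inj₁ (back-source bp))
    cmpᵢ (snoc bp refl refl) (snoc bx refl h) with RI-cmp (sym h)
    ... | inj₁ l = inj₁ (this l)
    ... | inj₂ (inj₂ l) = inj₂ (inj₂ (this l))
    ... | inj₂ (inj₁ refl) with cmpᵢ bp bx
    ...   | inj₁ l = inj₁ (next l)
    ...   | inj₂ (inj₁ refl) = inj₂ (inj₁ refl)
    ...   | inj₂ (inj₂ l) = inj₂ (inj₂ (next l))

    cmpₒ : ∀ {v q z} → Fwd v q → Fwd v z → q <ₒ z ⊎ q ≡ z ⊎ z <ₒ q
    cmpₒ nil fz = inj₂ (inj₁ (sym (fwd-sink fz)))
    cmpₒ fq@(cons _ _) nil = inj₂ (inj₁ (fwd-sink fq))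
    cmpₒ (cons refl fq) (cons h fz) with RO-cmp (sym h)
    ... | inj₁ l = inj₁ (this l)
    ... | inj₂ (inj₂ l) = inj₂ (inj₂ (this l))
    ... | inj₂ (inj₁ refl) with cmpₒ fq fz
    ...   | inj₁ l = inj₁ (next l)
    ...   | inj₂ (inj₁ refl) = inj₂ (inj₁ refl)
    ...   | inj₂ (inj₂ l) = inj₂ (inj₂ (next l))

    -- Y <ᶜʷ X at v; in-parts are listed backwards, so that Yv = reverse p and vY = q
    record _≺_ (Y X : List E) : Set where
      constructor conf
      field
        {v} : V
        {p q x z} : List E
        Y≡ : Y ≡ p ʳ++ q
        X≡ : X ≡ x ʳ++ z
        bp : Back v p
        fq : Fwd v q
        bx : Back v x
        fz : Fwd v z
        p<x : p <ᵢ x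
        z<q : z <ₒ q

    -- an incoherence with X at a vertex strictly before w, caused by p alone
    record PreC (w : V) (p X : List E) : Set where
      constructor prec
      field
        {v} : V
        r {a x z} : List E
        p≡ : p ≡ r ++ a
        X≡ : X ≡ x ʳ++ z
        sr : Seg v r w
        ba : Back v a
        bx : Back v x
        fz : Fwd v z
        a<x : a <ᵢ x
        z<r : ∀ q₀ → z <ₒ r ʳ++ q₀

    record PostC (w : V) (q X : List E) : Set where
      constructor postc
      field
        {v} : V
        r {b x z} : List E
        q≡ : q ≡ r ʳ++ b
        X≡ : X ≡ x ʳ++ z
        sr : Seg w r v
        fb : Fwd v b
        bx : Back v x
        fz : Fwd v z
        r<x : ∀ p₀ → r ++ p₀ <ᵢ x
        z<b : z <ₒ b

    record Meet (w : V) (p q X : List E) : Set where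
      constructor meet
      field
        {x z} : List E
        X≡ : X ≡ x ʳ++ z
        bx : Back w x
        fz : Fwd w z
        p<x : p <ᵢ x
        z<q : z <ₒ q

    pre⇒≺ : ∀ {w p X q₀} → PreC w p X → Fwd w q₀ → p ʳ++ q₀ ≺ X
    pre⇒≺ (prec r refl X≡ sr ba bx fz a<x z<r) fq =
      conf (++-ʳ++ r) X≡ ba (seg-path r sr fq) bx fz a<x (z<r _)

    post⇒≺ : ∀ {w p₀ q X} → PostC w q X → Back w p₀ → p₀ ʳ++ q ≺ X
    post⇒≺ (postc r refl X≡ sr fb bx fz r<x z<b) bp =
      conf (sym (++-ʳ++ r)) X≡ (seg-++ r sr bp) fb bx fz (r<x _) z<b

    -- If the clash is at a vertex before `w`, ask whether the out-parts separate before `w`. If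
    -- they do, `p` alone is responsible; if not, `X` follows the route up to `w` and the same clash
    -- is visible there. After `w` the in-parts are treated likewise.
    locate : ∀ {w p q X} → Back w p → Fwd w q → p ʳ++ q ≺ X → PreC w p X ⊎ PostC w q X ⊎ Meet w p q X
    locate {p = p} {q} bp fq (conf {p = a} {b} {x} {z} Y≡ X≡ ba fb bx fz a<x z<b) with ʳ++-overlap p q a b Y≡
    ... | inj₁ (r , refl , refl) with lex-ʳ++⁻ r z<b
    ...   | inj₂ h = inj₁ (prec r refl X≡ (seg-suffix r bp ba) ba bx fz a<x h)
    ...   | inj₁ (z′ , refl , l) =
              inj₂ (inj₂ (meet (trans X≡ (sym (++-ʳ++ r))) (seg-++ r sr bx) (path-suffix r fz sr) (lex-++ r a<x) l))
              where sr = seg-suffix r bp ba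
    locate {p = p} {q} bp fq (conf {p = a} {b} {x} {z} Y≡ X≡ ba fb bx fz a<x z<b)
        | inj₂ (r , refl , refl) with lex-++⁻ r a<x
    ...   | inj₂ h = inj₂ (inj₁ (postc r refl X≡ (seg-suffix r ba bp) fb bx fz h z<b))
    ...   | inj₁ (x′ , refl , l) with seg-++⁻ r bx
    ...     | w , sr′ , bx′ = inj₂ (inj₂ (meet (trans X≡ (++-ʳ++ r)) bxw
                                     (seg-path r sr fz) l (lex-ʳ++ r z<b)))
              where
              sr = seg-suffix r ba bp
              bxw = subst (λ v → Back v x′) (seg-start r sr′ sr) bx′
                where
                seg-start : ∀ {u v w} r → Seg u r w → Seg v r w → u ≡ v
                seg-start [] nil nil = refl
                seg-start (_ ∷ r) (snoc σ refl _) (snoc τ refl _) = seg-start r σ τ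

    _≺?_ : ∀ Y X → Dec (Y ≺ X)
    Y ≺? X = map′ to fro (any? (λ (p , q) → any? (λ (x , z) → body? p q x z) (splits [] X)) (splits [] Y))
      where
      Body : (p q x z : List E) → Set
      Body p q x z = ∃ λ v → Back v p × Fwd v q × Back v x × Fwd v z × p <ᵢ x × z <ₒ q
      body? : ∀ p q x z → Dec (Body p q x z)
      body? p q x z = Fin.any? λ v → seg? _ p v ×-dec path? v q _ ×-dec seg? _ x v ×-dec path? v z _ ×-dec (p <ᵢ? x) ×-dec (z <ₒ? q)
      to : Any (λ (p , q) → Any (λ (x , z) → Body p q x z) (splits [] X)) (splits [] Y) → Y ≺ X
      to h with find h
      ... | _ , i , h′ with find h′
      ...   | _ , j , v , a , b , c , d , l , l′ =
                conf (sym (∈-splits⁻ [] Y i)) (sym (∈-splits⁻ [] X j)) a b c d l l′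
      fro : Y ≺ X → Any (λ (p , q) → Any (λ (x , z) → Body p q x z) (splits [] X)) (splits [] Y)
      fro (conf {v} {p} {q} {x} {z} refl refl a b c d l l′) =
        lose (∈-splits⁺ p q) (lose (∈-splits⁺ x z) (v , a , b , c , d , l , l′))

    ≺-irrefl : ∀ {Y} → ¬ Y ≺ Y
    ≺-irrefl (conf Y≡ X≡ bp _ bx _ l _) with split-unique bp bx (trans (sym Y≡) X≡)
    ... | refl , _ = irrᵢ l

    record Max (K : List (Route G)) : Set where
      field
        routes : ∀ {R} → R ∈ K → IsRoute G R
        coherent : ∀ {R X} → R ∈ K → X ∈ K → ¬ R ≺ X
        complete : ∀ {Y} → IsRoute G Y → (∀ {X} → X ∈ K → ¬ Y ≺ X × ¬ X ≺ Y) → Y ∈ K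

  ≺-op : ∀ O {X Y} → Base._≺_ O X Y → Base._≺_ (op O) Y X
  ≺-op O (Base.conf a b c d e f l l′) = Base.conf b a e f c d (lex-flip l) (lex-flip l′)

  ≺-unop : ∀ O {X Y} → Base._≺_ (op O) X Y → Base._≺_ O Y X
  ≺-unop O (Base.conf a b c d e f l l′) = Base.conf b a e f c d (lex-flip l) (lex-flip l′)

  max-op : ∀ O {K} → Base.Max O K → Base.Max (op O) K
  max-op O mx = record
    { routes = routes
    ; coherent = λ i j h → coherent j i (≺-unop O h)
    ; complete = λ y h → complete y λ i → (λ l → proj₂ (h i) (≺-op O l)) , (λ l → proj₁ (h i) (≺-op O l))
    }
    where open Base.Max mx

  -- The pairs of a maximal clique at a vertex

  record At (K : List (Route G)) (w : V) (p q : List E) : Set where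
    constructor at
    field
      mem : p ʳ++ q ∈ K
      back : Back w p
      fwd : Fwd w q

  open At public

  pairs : List (Route G) → List (List E × List E)
  pairs = concatMap (splits [])

  pairs⁺ : ∀ {K p q} → p ʳ++ q ∈ K → (p , q) ∈ pairs K
  pairs⁺ {p = p} {q} i = ∈-concatMap⁺ (splits []) (lose i (∈-splits⁺ p q))

  pairs⁻ : ∀ {K p q} → (p , q) ∈ pairs K → p ʳ++ q ∈ K
  pairs⁻ {K} i with find (∈-concatMap⁻ (splits []) {xs = K} i)
  ... | R , R∈ , j = subst (_∈ K) (sym (∈-splits⁻ [] R j)) R∈

  -- The out-parts separate either before the last edge `e` or at its tail. In the second case the
  -- word `e ∷ []` stands for the edge: nothing lies below the empty word, so `z <ₒ e ∷ []` compares
  -- just the first edge of `z` with `e`.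
  pre-shrink : ∀ O {e p X} → Base.PreC O (head G e) (e ∷ p) X →
               Base.PreC O (tail G e) p X ⊎ Base.Meet O (tail G e) p (e ∷ []) X
  pre-shrink O (Base.prec [] _ _ _ _ _ _ _ z<) = ⊥-elim (Base.irrₒ O (z< _))
  pre-shrink O (Base.prec (e ∷ r) refl X≡ (snoc sr refl _) ba bx fz a<x z<) with lex-ʳ++⁻ r (z< [])
  ... | inj₂ h = inj₁ (Base.prec r refl X≡ sr ba bx fz a<x (λ q₀ → h q₀))
  ... | inj₁ (z , refl , l) =
          inj₂ (Base.meet (trans X≡ (sym (++-ʳ++ r))) (seg-++ r sr bx) (path-suffix r fz sr) (lex-++ r a<x) l)

  module Chain (O : Orders) (K : List (Route G)) (mx : Base.Max O K) where
    open Base O hiding (Max)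
    open Base.Max mx public
    module Oᵒ = Base (op O)

    at-route : ∀ {w p q} → p ʳ++ q ∈ K → Back w p → At K w p q
    at-route i b = at i b (path-suffix _ (routes i) b)

    met : ∀ {w X x z} → X ∈ K → X ≡ x ʳ++ z → Back w x → At K w x z
    met X∈ refl bx = at-route X∈ bx

    coh : ∀ {w p q x z} → At K w p q → At K w x z → p <ᵢ x → ¬ z <ₒ q
    coh a b l l′ = coherent (mem a) (mem b) (conf refl refl (back a) (fwd a) (back b) (fwd b) l l′)

    infix 4 _<ₗ_ _<ₗ?_

    -- On the pairs of `K` at one vertex this extends the product order, by `coh`.
    _<ₗ_ : Rel (List E × List E) 0ℓ
    (p , q) <ₗ (x , z) = p <ᵢ x ⊎ (p ≡ x × q <ₒ z)

    _<ₗ?_ : ∀ a b → Dec (a <ₗ b)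
    (p , q) <ₗ? (x , z) = (p <ᵢ? x) ⊎-dec ((p ≟ₗ x) ×-dec (q <ₒ? z))

    <ₗ-trans : Transitive _<ₗ_
    <ₗ-trans (inj₁ l) (inj₁ l′) = inj₁ (transᵢ l l′)
    <ₗ-trans (inj₁ l) (inj₂ (refl , _)) = inj₁ l
    <ₗ-trans (inj₂ (refl , _)) (inj₁ l) = inj₁ l
    <ₗ-trans (inj₂ (refl , l)) (inj₂ (refl , l′)) = inj₂ (refl , transₒ l l′)

    <ₗ-irrefl : ∀ {a} → ¬ a <ₗ a
    <ₗ-irrefl (inj₁ l) = irrᵢ l
    <ₗ-irrefl (inj₂ (_ , l)) = irrₒ l

    module _ {P : List E × List E → Set} (P? : Decidable P) (w : V) where

      private
        Φ : List E × List E → Set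
        Φ c = Back w (proj₁ c) × P c

        at? : Decidable Φ
        at? c = seg? _ (proj₁ c) w ×-dec P? c

      abstract
        some? : Dec (∃₂ λ p q → At K w p q × P (p , q))
        some? = map′ to (λ (_ , _ , a , φ) → lose (pairs⁺ (mem a)) (back a , φ)) (any? at? (pairs K))
          where
          to : Any Φ (pairs K) → ∃₂ λ p q → At K w p q × P (p , q)
          to h with find h
          ... | (p , q) , i , b , φ = p , q , at-route (pairs⁻ i) b , φ

      module _ {_⊏_ : Rel (List E × List E) 0ℓ} (_⊏?_ : ∀ x y → Dec (x ⊏ y)) (⊏-trans : Transitive _⊏_) (⊏-irrefl : ∀ {x} → ¬ x ⊏ x) where

        abstract
          extremal-at : ∀ {p q} → At K w p q → P (p , q) →
                        ∃₂ λ p q → At K w p q × P (p , q) ×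
                          (∀ {x z} → At K w x z → P (x , z) → ¬ (p , q) ⊏ (x , z))
          extremal-at a φ with extremal _⊏?_ ⊏-trans ⊏-irrefl {P = Φ} at? (pairs K) (pairs⁺ (mem a)) (back a , φ)
          ... | (p , q) , i , (b , ψ) , max =
                  p , q , at-route (pairs⁻ i) b , ψ , λ a φ → max (pairs⁺ (mem a)) (back a , φ)

      abstract
        least : ∀ {p q} → At K w p q → P (p , q) →
                ∃₂ λ p q → At K w p q × P (p , q) × (∀ {x z} → At K w x z → P (x , z) → ¬ (x , z) <ₗ (p , q))
        least = extremal-at (flip _<ₗ?_) (flip <ₗ-trans) <ₗ-irrefl

        greatest : ∀ {p q} → At K w p q → P (p , q) →
                   ∃₂ λ p q → At K w p q × P (p , q) × (∀ {x z} → At K w x z → P (x , z) → ¬ (p , q) <ₗ (x , z))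
        greatest = extremal-at _<ₗ?_ <ₗ-trans <ₗ-irrefl

    -- A clash decided before `w` would also affect `p ʳ++ q₀`, one decided after `w` would affect
    -- `p₀ ʳ++ q`; the hypothesis excludes those at `w`.
    splice : ∀ {w p q p₀ q₀} → At K w p q₀ → At K w p₀ q →
             (∀ {x z} → At K w x z → ¬ (p <ᵢ x × z <ₒ q) × ¬ (x <ᵢ p × q <ₒ z)) → At K w p q
    splice {w} {p} {q} a b h = at-route (complete (seg-path p (back a) (fwd b)) λ X∈ → below X∈ , above X∈) (back a)
      where
      below : ∀ {X} → X ∈ K → ¬ p ʳ++ q ≺ X
      below X∈ l with locate (back a) (fwd b) l
      ... | inj₁ pre = coherent (mem a) X∈ (pre⇒≺ pre (fwd a))
      ... | inj₂ (inj₁ post) = coherent (mem b) X∈ (post⇒≺ post (back b))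
      ... | inj₂ (inj₂ (meet X≡ bx _ l l′)) = proj₁ (h (met X∈ X≡ bx)) (l , l′)
      above : ∀ {X} → X ∈ K → ¬ X ≺ p ʳ++ q
      above X∈ l with Oᵒ.locate (back a) (fwd b) (≺-op O l)
      ... | inj₁ pre = coherent X∈ (mem a) (≺-unop O (Oᵒ.pre⇒≺ pre (fwd a)))
      ... | inj₂ (inj₁ post) = coherent X∈ (mem b) (≺-unop O (Oᵒ.post⇒≺ post (back b)))
      ... | inj₂ (inj₂ (Base.meet X≡ bx _ l l′)) = proj₂ (h (met X∈ X≡ bx)) (lex-flip l , lex-flip l′)

    record Succ (w : V) (p q : List E) : Set where
      constructor succ
      field
        {p′ q′} : List E
        at′ : At K w p′ q′
        step : (p ≡ p′ × q <ₒ q′) ⊎ (p <ᵢ p′ × q ≡ q′)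
        none : ∀ {x z} → At K w x z → (p , q) <ₗ (x , z) → ¬ (x , z) <ₗ (p′ , q′)

    -- If both coordinates increased, the splice (p , q′) would lie strictly in between.
    abstract
      successor : ∀ {w p q y z} → At K w p q → At K w y z → (p , q) <ₗ (y , z) → Succ w p q
      successor {w} {p} {q} a b l with least ((p , q) <ₗ?_) w b l
      ... | p′ , q′ , a′ , inj₂ e , none = succ a′ (inj₁ e) none
      ... | p′ , q′ , a′ , inj₁ p<p′ , none with cmpₒ (fwd a) (fwd a′)
      ...   | inj₂ (inj₁ e) = succ a′ (inj₂ (p<p′ , e)) none
      ...   | inj₂ (inj₂ q′<q) = ⊥-elim (coh a a′ p<p′ q′<q)
      ...   | inj₁ q<q′ = ⊥-elim (none (splice a a′ free) (inj₂ (refl , q<q′)) (inj₁ p<p′))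
        where
        free : ∀ {x z} → At K w x z → ¬ (p <ᵢ x × z <ₒ q′) × ¬ (x <ᵢ p × q′ <ₒ z)
        free {x} {z} c = up , λ (x<p , q′<z) → coh c a x<p (transₒ q<q′ q′<z)
          where
          up : ¬ (p <ᵢ x × z <ₒ q′)
          up (p<x , z<q′) with cmpᵢ (back c) (back a′)
          ... | inj₁ x<p′ = none c (inj₁ p<x) (inj₁ x<p′)
          ... | inj₂ (inj₁ x≡p′) = none c (inj₁ p<x) (inj₂ (x≡p′ , z<q′))
          ... | inj₂ (inj₂ p′<x) = coh a′ c p′<x z<q′

    starts? : (f : E) (q : List E) → Dec (∃ λ q₁ → q ≡ f ∷ q₁)
    starts? f [] = no λ ()
    starts? f (e ∷ q) = map′ (λ { refl → q , refl }) (λ { (_ , refl) → refl }) (e Fin.≟ f)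

    abstract
      -- Among the pairs below `x₀` that continue with `f`, take one with the greatest out-part and
      -- splice it to `x₀`. A pair above `x₀` clashing with the result clashes with the chosen pair;
      -- one below has either a greater first edge, excluded by hypothesis, or a greater rest,
      -- excluded by the choice.
      extend : ∀ {w x₀ z₀ y f q₀} → At K w x₀ z₀ → At K w y (f ∷ q₀) → y <ᵢ x₀ →
               (∀ {x g z} → At K w x (g ∷ z) → x <ᵢ x₀ → ¬ RO f g) → ∃ λ q → At K w x₀ (f ∷ q)
      extend {w} {x₀} {f = f} a b y<x₀ h
        with extremal-at {P = λ (y , q) → y <ᵢ x₀ × (∃ λ q₁ → q ≡ f ∷ q₁)} (λ (y , q) → (y <ᵢ? x₀) ×-dec starts? f q) w
               (λ (_ , q) (_ , z) → q <ₒ? z) transₒ irrₒ b (y<x₀ , _ , refl)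
      ... | y , _ , b′ , (y<x₀ , q , refl) , max = q , splice a b′ λ c → up c , down c
        where
        up : ∀ {x z} → At K w x z → ¬ (x₀ <ᵢ x × z <ₒ f ∷ q)
        up c (x₀<x , z<) = coh b′ c (transᵢ y<x₀ x₀<x) z<
        down : ∀ {x z} → At K w x z → ¬ (x <ᵢ x₀ × f ∷ q <ₒ z)
        down c (x<x₀ , this r) = h c x<x₀ r
        down c (x<x₀ , next l) = max c (x<x₀ , _ , refl) (next l)

    -- Here `p` may be any path from the source, possibly already clashing with `K`; all one can ask
    -- of `q` is that it adds no clash.
    record Free (w : V) (p q : List E) (X : Route G) : Set where
      field
        below : p ʳ++ q ≺ X → PreC w p X
        above : p ʳ++ q Oᵒ.≺ X → Oᵒ.PreC w p X

    abstract
      used? : ∀ w → Dec (∃₂ λ p q → At K w p q × ⊤)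
      used? = some? (λ _ → yes tt)

    -- Follow the greatest route of K at b whose part before b does not exceed p, or the least
    -- route at b if there is none.
    extend-right : ∀ b {p} → Back b p → ∃ λ q → Fwd b q × (∀ {X} → X ∈ K → Free b p q X)
    extend-right b = go b (>-wellFounded b)
      where
      settle : ∀ {b p p₀ q} → Back b p → At K b p₀ q →
               (∀ {x z} → At K b x z → ¬ (p <ᵢ x × z <ₒ q) × ¬ (x <ᵢ p × q <ₒ z)) → ∀ {X} → X ∈ K → Free b p q X
      settle {b} {p} {_} {q} bp a h {X} X∈ = record { below = below ; above = above }
        where
        below : p ʳ++ q ≺ X → PreC b p X
        below l with locate bp (fwd a) l
        ... | inj₁ pre = pre
        ... | inj₂ (inj₁ post) = ⊥-elim (coherent (mem a) X∈ (post⇒≺ post (back a)))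
        ... | inj₂ (inj₂ (meet X≡ bx _ l l′)) = ⊥-elim (proj₁ (h (met X∈ X≡ bx)) (l , l′))
        above : p ʳ++ q Oᵒ.≺ X → Oᵒ.PreC b p X
        above l with Oᵒ.locate bp (fwd a) l
        ... | inj₁ pre = pre
        ... | inj₂ (inj₁ post) = ⊥-elim (coherent X∈ (mem a) (≺-unop O (Oᵒ.post⇒≺ post (back a))))
        ... | inj₂ (inj₂ (Base.meet X≡ bx _ l l′)) = ⊥-elim (proj₂ (h (met X∈ X≡ bx)) (lex-flip l , lex-flip l′))

      go : ∀ b → Acc Fin._>_ b → ∀ {p} → Back b p → ∃ λ q → Fwd b q × (∀ {X} → X ∈ K → Free b p q X)
      go b (acc rec) {p} bp with used? b
      ... | yes (_ , _ , a , _) with some? {λ (x , _) → ¬ p <ᵢ x} (λ (x , _) → ¬? (p <ᵢ? x)) b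
      ...   | yes (_ , _ , a₁ , ≮₁) with greatest (λ (x , _) → ¬? (p <ᵢ? x)) b a₁ ≮₁
      ...     | p₀ , q , a₀ , p≮p₀ , max = q , fwd a₀ , settle bp a₀ λ c → up c , down c
        where
        up : ∀ {x z} → At K b x z → ¬ (p <ᵢ x × z <ₒ q)
        up c (p<x , z<q) with cmpᵢ (back a₀) bp
        ... | inj₁ p₀<p = coh a₀ c (transᵢ p₀<p p<x) z<q
        ... | inj₂ (inj₁ refl) = coh a₀ c p<x z<q
        ... | inj₂ (inj₂ p<p₀) = p≮p₀ p<p₀
        down : ∀ {x z} → At K b x z → ¬ (x <ᵢ p × q <ₒ z)
        down c (x<p , q<z) with cmpᵢ (back a₀) (back c)
        ... | inj₁ p₀<x = max c (λ p<x → irrᵢ (transᵢ p<x x<p)) (inj₁ p₀<x)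
        ... | inj₂ (inj₁ e) = max c (λ p<x → irrᵢ (transᵢ p<x x<p)) (inj₂ (e , q<z))
        ... | inj₂ (inj₂ x<p₀) = coh c a₀ x<p₀ q<z
      go b (acc rec) {p} bp | yes (_ , _ , a , _) | no all with least (λ _ → yes tt) b a tt
      ...     | p₀ , q , a₀ , _ , min = q , fwd a₀ , settle bp a₀ λ c → up c , down c
        where
        up : ∀ {x z} → At K b x z → ¬ (p <ᵢ x × z <ₒ q)
        up c (p<x , z<q) with cmpᵢ (back a₀) (back c)
        ... | inj₁ p₀<x = coh a₀ c p₀<x z<q
        ... | inj₂ (inj₁ e) = min c tt (inj₂ (sym e , z<q))
        ... | inj₂ (inj₂ x<p₀) = min c tt (inj₁ x<p₀)
        down : ∀ {x z} → At K b x z → ¬ (x <ᵢ p × q <ₒ z)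
        down c (x<p , q<z) = all (_ , _ , c , λ p<x → irrᵢ (transᵢ p<x x<p))
      go b (acc rec) {p} bp | no unused with b Fin.≟ t G
      ... | yes refl = [] , nil , λ X∈ → record { below = below X∈ ; above = above X∈ }
        where
        below : ∀ {X} → X ∈ K → p ʳ++ [] ≺ X → PreC b p X
        below X∈ l with locate bp nil l
        ... | inj₁ pre = pre
        ... | inj₂ (inj₁ (postc r q≡ _ _ _ _ _ _ z<)) = ⊥-elim (¬lex-[] r q≡ z<)
        above : ∀ {X} → X ∈ K → p ʳ++ [] Oᵒ.≺ X → Oᵒ.PreC b p X
        above X∈ l with Oᵒ.locate bp nil l
        ... | inj₁ pre = pre
        ... | inj₂ (inj₁ (Base.postc r q≡ _ _ _ _ _ _ z<)) = ⊥-elim (¬lex-[] r q≡ z<)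
      -- Where no route of `K` passes, any outgoing edge will do: a new clash at `b` needs a route
      -- of `K` through `b`.
      ... | no b≢t with t-unique G b b≢t
      ...   | e , refl with go (head G e) (rec (tail<head G e)) (snoc bp refl refl)
      ...     | q , fq , free = e ∷ q , cons refl fq , λ X∈ → record { below = below X∈ ; above = above X∈ }
        where
        below : ∀ {X} → X ∈ K → p ʳ++ (e ∷ q) ≺ X → PreC b p X
        below X∈ l with pre-shrink O (Free.below (free X∈) l)
        ... | inj₁ pre = pre
        ... | inj₂ (meet X≡ bx _ _ _) = ⊥-elim (unused (_ , _ , met X∈ X≡ bx , tt))
        above : ∀ {X} → X ∈ K → p ʳ++ (e ∷ q) Oᵒ.≺ X → Oᵒ.PreC b p X
        above X∈ l with pre-shrink (op O) (Free.above (free X∈) l)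
        ... | inj₁ pre = pre
        ... | inj₂ (Base.meet X≡ bx _ _ _) = ⊥-elim (unused (_ , _ , met X∈ X≡ bx , tt))

    record Fits (w : V) (p : List E) (f : E) (X : Route G) : Set where
      field
        ¬pre : ¬ PreC w p X
        ¬preᵒ : ¬ Oᵒ.PreC w p X
        ¬meet : ¬ Meet w p (f ∷ []) X
        ¬meetᵒ : ¬ Oᵒ.Meet w p (f ∷ []) X

    -- If `K` visits the tail of `f`, take the in-part of the greatest pair whose first edge
    -- precedes `f`, or of the least pair if there is none; it lies on a route of `K` and so causes
    -- no earlier clash. Otherwise enter by any edge and recurse.
    extend-left : ∀ f → ∃ λ p → Back (tail G f) p × (∀ {X} → X ∈ K → Fits (tail G f) p f X)
    extend-left f = go (tail G f) (<-wellFoundedᶠ (tail G f)) f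
      where
      settle : ∀ {a p q f} → At K a p q → (∀ {x z} → At K a x z → ¬ (p <ᵢ x × z <ₒ f ∷ []) × ¬ (x <ᵢ p × f ∷ [] <ₒ z)) →
               ∀ {X} → X ∈ K → Fits a p f X
      settle a h X∈ = record
        { ¬pre = λ pre → coherent (mem a) X∈ (pre⇒≺ pre (fwd a))
        ; ¬preᵒ = λ pre → coherent X∈ (mem a) (≺-unop O (Oᵒ.pre⇒≺ pre (fwd a)))
        ; ¬meet = λ { (meet X≡ bx _ l l′) → proj₁ (h (met X∈ X≡ bx)) (l , l′) }
        ; ¬meetᵒ = λ { (Base.meet X≡ bx _ l l′) → proj₂ (h (met X∈ X≡ bx)) (lex-flip l , lex-flip l′) }
        }

      go : ∀ a → Acc Fin._<_ a → ∀ f → ∃ λ p → Back a p × (∀ {X} → X ∈ K → Fits a p f X)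
      go a (acc rec) f with used? a
      ... | yes (_ , _ , b , _) with some? {λ (_ , z) → z <ₒ f ∷ []} (λ (_ , z) → z <ₒ? f ∷ []) a
      ...   | yes (_ , _ , a₁ , l₁) with greatest (λ (_ , z) → z <ₒ? f ∷ []) a a₁ l₁
      ...     | p , q , a₀ , q<f , max = p , back a₀ , settle a₀ λ c →
                  (λ (p<x , z<f) → max c z<f (inj₁ p<x)) , (λ (x<p , f<z) → coh c a₀ x<p (transₒ q<f f<z))
      go a (acc rec) f | yes (_ , _ , b , _) | no none with least (λ _ → yes tt) a b tt
      ...     | p , q , a₀ , _ , min = p , back a₀ , settle a₀ λ c →
                  (λ (_ , z<f) → none (_ , _ , c , z<f)) , (λ (x<p , _) → min c tt (inj₁ x<p))
      go a (acc rec) f | no unused with a Fin.≟ s G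
      ... | yes refl = [] , nil , λ X∈ → record
                { ¬pre = λ { (prec [] refl _ _ _ _ _ () _) } ; ¬preᵒ = λ { (Base.prec [] refl _ _ _ _ _ () _) }
                ; ¬meet = λ { (meet _ _ _ () _) } ; ¬meetᵒ = λ { (Base.meet _ _ _ () _) } }
      ... | no a≢s with s-unique G a a≢s
      ...   | g , refl with go (tail G g) (rec (tail<head G g)) g
      ...     | p , bp , fits = g ∷ p , snoc bp refl refl , λ X∈ → record
                { ¬pre = λ pre → [ Fits.¬pre (fits X∈) , Fits.¬meet (fits X∈) ] (pre-shrink O pre)
                ; ¬preᵒ = λ pre → [ Fits.¬preᵒ (fits X∈) , Fits.¬meetᵒ (fits X∈) ] (pre-shrink (op O) pre)
                ; ¬meet = λ { (meet X≡ bx _ _ _) → unused (_ , _ , met X∈ X≡ bx , tt) }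
                ; ¬meetᵒ = λ { (Base.meet X≡ bx _ _ _) → unused (_ , _ , met X∈ X≡ bx , tt) } }

    abstract
      -- The right extension adds no clash to those of `f ∷ p`, and by `pre-shrink` these are the
      -- ones that `Fits` excludes.
      edge-used : ∀ f → ∃₂ λ p q → At K (tail G f) p (f ∷ q)
      edge-used f with extend-left f
      ... | p , bp , fits with extend-right (head G f) (snoc bp refl refl)
      ... | q , fq , free = p , q , at-route (complete (seg-path p bp (cons refl fq)) λ X∈ →
              (λ l → [ Fits.¬pre (fits X∈) , Fits.¬meet (fits X∈) ] (pre-shrink O (Free.below (free X∈) l))) ,
              (λ l → [ Fits.¬preᵒ (fits X∈) , Fits.¬meetᵒ (fits X∈) ] (pre-shrink (op O) (Free.above (free X∈) (≺-op O l))))) bp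

  -- Covers preserve the cw relation

  record Swap (C D : List (Route G)) (R R′ : Route G) : Set where
    field
      R∈ : R ∈ C
      R′∈ : R′ ∈ D
      C⇒D : ∀ {X} → X ∈ C → X ≢ R → X ∈ D
      D⇒C : ∀ {X} → X ∈ D → X ≢ R′ → X ∈ C

  -- No order between the halves is recorded, because the recursion of `resolve` may end in the
  -- opposite orientation; `swap-cw` recovers it.
  record Resolved (C D : List (Route G)) (R R′ : Route G) : Set where
    field
      {u} : V
      {p q p′ q′} : List E
      R≡ : R ≡ p ʳ++ q
      R′≡ : R′ ≡ p′ ʳ++ q′
      bp : Back u p
      fq : Fwd u q
      bp′ : Back u p′
      fq′ : Fwd u q′
      A∈D : p ʳ++ q′ ∈ D
      B∈D : p′ ʳ++ q ∈ D

  pre-shorter : ∀ {O w p X} (pre : Base.PreC O w p X) → length (Base.PreC.a pre) ℕ.< length p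
  pre-shorter {O} (Base.prec [] _ _ _ _ _ _ _ z<) = ⊥-elim (Base.irrₒ O (z< _))
  pre-shorter (Base.prec (e ∷ r) {a} refl _ _ _ _ _ _ _) = s≤s (suffix r a)
    where
    suffix : ∀ (r a : List E) → length a ℕ.≤ length (r ++ a)
    suffix [] a = ℕ.≤-refl
    suffix (_ ∷ r) a = ℕ.m≤n⇒m≤1+n (suffix r a)

  -- The resolvents at the first vertex of incoherence belong to both cliques; the
  -- recursion moves to an earlier vertex whenever the first resolvent clashes with R′.
  resolve : ∀ O {C D R R′} → Base.Max O C → Base.Max O D → Swap C D R R′ →
            (c : Base._≺_ O R R′) → Acc ℕ._<_ (length (Base._≺_.p c)) → ¬ ¬ Resolved C D R R′
  resolve O {C} {D} {R} {R′} mC mD sw (Base.conf {u} {p} {q} {p′} {q′} refl refl bp fq bp′ fq′ p<p′ q′<q) (acc rec) k =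
    k record { R≡ = refl ; R′≡ = refl ; bp = bp ; fq = fq ; bp′ = bp′ ; fq′ = fq′ ; A∈D = A∈D ; B∈D = B∈D }
    where
    open Base O
    open Swap sw
    module Oᵒ = Base (op O)
    module C = Max mC
    module D = Max mD

    A B : Route G
    A = p ʳ++ q′
    B = p′ ʳ++ q

    A≢R′ : A ≢ R′
    A≢R′ eq with split-unique bp bp′ eq
    ... | refl , _ = irrᵢ p<p′

    A-shared : ∀ {X} → X ∈ C → X ∈ D → ¬ A ≺ X × ¬ X ≺ A
    A-shared {X} X∈C X∈D = below , above
      where
      below : ¬ A ≺ X
      below l with locate bp fq′ l
      ... | inj₁ pre = C.coherent R∈ X∈C (pre⇒≺ pre fq)
      ... | inj₂ (inj₁ post) = D.coherent R′∈ X∈D (post⇒≺ post bp′)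
      ... | inj₂ (inj₂ (meet X≡ bx fz l l′)) = C.coherent R∈ X∈C (conf refl X≡ bp fq bx fz l (transₒ l′ q′<q))
      above : ¬ X ≺ A
      above l with Oᵒ.locate bp fq′ (≺-op O l)
      ... | inj₁ pre = C.coherent X∈C R∈ (≺-unop O (Oᵒ.pre⇒≺ pre fq))
      ... | inj₂ (inj₁ post) = D.coherent X∈D R′∈ (≺-unop O (Oᵒ.post⇒≺ post bp′))
      ... | inj₂ (inj₂ (Base.meet X≡ bx fz l l′)) =
              D.coherent X∈D R′∈ (conf X≡ refl bx fz bp′ fq′ (transᵢ (lex-flip l) p<p′) (lex-flip l′))

    B-shared : ∀ {X} → X ∈ C → X ∈ D → ¬ B ≺ X × ¬ X ≺ B
    B-shared {X} X∈C X∈D = below , above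
      where
      below : ¬ B ≺ X
      below l with locate bp′ fq l
      ... | inj₁ pre = D.coherent R′∈ X∈D (pre⇒≺ pre fq′)
      ... | inj₂ (inj₁ post) = C.coherent R∈ X∈C (post⇒≺ post bp)
      ... | inj₂ (inj₂ (meet X≡ bx fz l l′)) = C.coherent R∈ X∈C (conf refl X≡ bp fq bx fz (transᵢ p<p′ l) l′)
      above : ¬ X ≺ B
      above l with Oᵒ.locate bp′ fq (≺-op O l)
      ... | inj₁ pre = D.coherent X∈D R′∈ (≺-unop O (Oᵒ.pre⇒≺ pre fq′))
      ... | inj₂ (inj₁ post) = C.coherent X∈C R∈ (≺-unop O (Oᵒ.post⇒≺ post bp))
      ... | inj₂ (inj₂ (Base.meet X≡ bx fz l l′)) =
              D.coherent X∈D R′∈ (conf X≡ refl bx fz bp′ fq′ (lex-flip l) (transₒ q′<q (lex-flip l′)))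

    ¬A≺R′ : ¬ A ≺ R′
    -- Such a clash is decided before `u` and makes `R` clash with `R′` there. The resolution at
    -- that earlier vertex is handed to the same `k`; this escape is why the result is doubly
    -- negated.
    ¬A≺R′ l with locate bp fq′ l
    ... | inj₁ pre@(prec r refl X≡ sr ba bx fz a<x z<) =
            resolve O mC mD sw (conf (++-ʳ++ r) X≡ ba (seg-path r sr fq) bx fz a<x (z< q)) (rec (pre-shorter pre)) k
    ... | inj₂ (inj₁ post) = ≺-irrefl (post⇒≺ post bp′)
    ... | inj₂ (inj₂ (meet X≡ bx _ _ l′)) with split-unique bp′ bx X≡
    ...   | refl , refl = irrₒ l′

    ¬R′≺A : ¬ R′ ≺ A
    ¬R′≺A l with Oᵒ.locate bp fq′ (≺-op O l)
    ... | inj₁ pre@(Base.prec r refl X≡ sr ba bx fz a<x z<) =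
            resolve (op O) (max-op O mC) (max-op O mD) sw
              (Base.conf (++-ʳ++ r) X≡ ba (seg-path r sr fq) bx fz a<x (z< q)) (rec (pre-shorter pre)) k
    ... | inj₂ (inj₁ post) = Oᵒ.≺-irrefl (Oᵒ.post⇒≺ post bp′)
    ... | inj₂ (inj₂ (Base.meet X≡ bx _ _ l′)) with split-unique bp′ bx X≡
    ...   | refl , refl = Oᵒ.irrₒ l′

    A∈D : A ∈ D
    A∈D = D.complete (seg-path p bp fq′) λ {X} X∈ → case X ≟ₗ R′ of λ
      { (yes refl) → ¬A≺R′ , ¬R′≺A ; (no X≢) → A-shared (D⇒C X∈ X≢) X∈ }

    A∈C : A ∈ C
    A∈C = D⇒C A∈D A≢R′

    ¬B≺R′ : ¬ B ≺ R′
    ¬B≺R′ l with Oᵒ.locate bp′ fq′ (≺-op O l)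
    ... | inj₁ pre = Oᵒ.≺-irrefl (Oᵒ.pre⇒≺ pre fq)
    -- The half `q′` also ends `A`, which by now is known to lie in both cliques.
    ... | inj₂ (inj₁ post) = proj₁ (B-shared A∈C A∈D) (≺-unop O (Oᵒ.post⇒≺ post bp))
    ... | inj₂ (inj₂ (Base.meet X≡ bx _ l′ _)) with split-unique bp′ bx X≡
    ...   | refl , refl = Oᵒ.irrᵢ l′

    ¬R′≺B : ¬ R′ ≺ B
    ¬R′≺B l with locate bp′ fq′ l
    ... | inj₁ pre = ≺-irrefl (pre⇒≺ pre fq)
    ... | inj₂ (inj₁ post) = proj₂ (B-shared A∈C A∈D) (post⇒≺ post bp)
    ... | inj₂ (inj₂ (meet X≡ bx _ l′ _)) with split-unique bp′ bx X≡
    ...   | refl , refl = irrᵢ l′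

    B∈D : B ∈ D
    B∈D = D.complete (seg-path p′ bp′ fq) λ {X} X∈ → case X ≟ₗ R′ of λ
      { (yes refl) → ¬B≺R′ , ¬R′≺B ; (no X≢) → B-shared (D⇒C X∈ X≢) X∈ }

  -- X ≺ R would be inherited by one of the resolvents or by R′.
  swap-cw : ∀ O {C D R R′} → Base.Max O C → Base.Max O D → Swap C D R R′ → Base._≺_ O R R′ →
            ∀ {X} → (∀ {Y} → Y ∈ D → ¬ Base._≺_ O X Y) → ∀ {Y} → Y ∈ C → ¬ Base._≺_ O X Y
  swap-cw O {R = R} mC mD sw R≺R′ {X} cw {Y} Y∈ X≺Y with Y ≟ₗ R
  ... | no Y≢R = cw (Swap.C⇒D sw Y∈ Y≢R) X≺Y
  ... | yes refl = resolve O mC mD sw R≺R′ (<-wellFounded _) impossible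
    where
    open Base O
    module Oᵒ = Base (op O)
    impossible : ¬ Resolved _ _ R _
    impossible record { R≡ = refl ; R′≡ = refl ; bp = bp ; fq = fq ; bp′ = bp′ ; fq′ = fq′ ; A∈D = A∈D ; B∈D = B∈D }
      -- If the clash were decided on one side of `u`, a resolvent would clash with `R′` inside `D`.
      -- So it occurs at `u`, in the given orientation.
      with locate bp fq R≺R′
    ... | inj₁ pre = Max.coherent mD A∈D (Swap.R′∈ sw) (pre⇒≺ pre fq′)
    ... | inj₂ (inj₁ post) = Max.coherent mD B∈D (Swap.R′∈ sw) (post⇒≺ post bp′)
    ... | inj₂ (inj₂ (meet R′≡ bx _ p<p′ q′<q)) with split-unique bp′ bx R′≡
    ...   | refl , refl with Oᵒ.locate bp fq (≺-op O X≺Y)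
    ...     | inj₁ pre = cw A∈D (≺-unop O (Oᵒ.pre⇒≺ pre fq′))
    ...     | inj₂ (inj₁ post) = cw B∈D (≺-unop O (Oᵒ.post⇒≺ post bp′))
    ...     | inj₂ (inj₂ (Base.meet X≡ bx fz l l′)) =
                cw (Swap.R′∈ sw) (conf X≡ refl bx fz bp′ fq′ (transᵢ (lex-flip l) p<p′) (transₒ q′<q (lex-flip l′)))

  -- Flipping a corner

  -- Three consecutive pairs (p , q), (p , q′), (p′ , q′) of the staircase of K at w.
  record Corner (O : Orders) (K : List (Route G)) (w : V) (p q p′ q′ : List E) : Set where
    open Base O
    field
      at₁ : At K w p q
      at₀ : At K w p q′
      at₂ : At K w p′ q′
      p<p′ : p <ᵢ p′
      q<q′ : q <ₒ q′
      gapₒ : ∀ {z} → At K w p z → z ≡ q′ ⊎ ¬ q <ₒ z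
      gapᵢ : ∀ {x z} → At K w x z → p <ᵢ x → ¬ x <ᵢ p′

  module Flip (O : Orders) (K : List (Route G)) (mx : Base.Max O K) {w : V} {p q p′ q′ : List E} (corner : Corner O K w p q p′ q′) where
    open Base O
    open Chain O K mx using (module Oᵒ; routes; coherent; complete; coh; met)
    open Corner corner

    R R′ P₁ P₂ : Route G
    R = p ʳ++ q′
    R′ = p′ ʳ++ q
    P₁ = p ʳ++ q
    P₂ = p′ ʳ++ q′

    flipped : List (Route G)
    flipped = R′ ∷ filter (λ X → ¬? (X ≟ₗ R)) K

    kept : ∀ {X} → X ∈ K → X ≢ R → X ∈ flipped
    kept X∈ X≢ = there (∈-filter⁺ (λ X → ¬? (X ≟ₗ R)) X∈ X≢)

    unkept : ∀ {X} → X ∈ flipped → X ≡ R′ ⊎ (X ∈ K × X ≢ R)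
    unkept (here X≡) = inj₁ X≡
    unkept (there i) = inj₂ (∈-filter⁻ (λ X → ¬? (X ≟ₗ R)) i)

    bp : Back w p
    bp = back at₀
    bp′ : Back w p′
    bp′ = back at₂
    fq : Fwd w q
    fq = fwd at₁
    fq′ : Fwd w q′
    fq′ = fwd at₀

    R≺R′ : R ≺ R′
    R≺R′ = conf refl refl bp fq′ bp′ fq p<p′ q<q′

    P₁≢R : P₁ ≢ R
    P₁≢R eq with split-unique bp bp eq
    ... | _ , refl = irrₒ q<q′

    P₂≢R : P₂ ≢ R
    P₂≢R eq with split-unique bp′ bp eq
    ... | refl , _ = irrᵢ p<p′

    ¬R′≺ : ∀ {X} → X ∈ K → ¬ R′ ≺ X
    ¬R′≺ X∈ l with locate bp′ fq l
    ... | inj₁ pre = coherent (mem at₂) X∈ (pre⇒≺ pre fq′)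
    ... | inj₂ (inj₁ post) = coherent (mem at₁) X∈ (post⇒≺ post bp)
    ... | inj₂ (inj₂ (meet X≡ bx _ l l′)) = coh at₂ (met X∈ X≡ bx) l (transₒ l′ q<q′)

    -- Below `p` the pair would clash with `(p , q)`; at `p` and between `p` and `p′` the gaps
    -- forbid it. So `R` is the only obstruction to `R′` at `w`.
    outside : ∀ {x z} → At K w x z → x ʳ++ z ≢ R → x <ᵢ p′ → ¬ q <ₒ z
    outside a ≢R x<p′ q<z with cmpᵢ (back a) bp
    ... | inj₁ x<p = coh a at₁ x<p q<z
    ... | inj₂ (inj₂ p<x) = gapᵢ a p<x x<p′
    ... | inj₂ (inj₁ refl) with gapₒ a
    ...   | inj₁ refl = ≢R refl
    ...   | inj₂ q≮z = q≮z q<z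

    ¬≺R′ : ∀ {X} → X ∈ K → X ≢ R → ¬ X ≺ R′
    ¬≺R′ X∈ X≢ l with Oᵒ.locate bp′ fq (≺-op O l)
    ... | inj₁ pre = coherent X∈ (mem at₂) (≺-unop O (Oᵒ.pre⇒≺ pre fq′))
    ... | inj₂ (inj₁ post) = coherent X∈ (mem at₁) (≺-unop O (Oᵒ.post⇒≺ post bp))
    ... | inj₂ (inj₂ (Base.meet refl bx _ l l′)) = outside (met X∈ refl bx) X≢ (lex-flip l) (lex-flip l′)

    -- One-sided towards `R`, since `R ≺ Z` is the very case to be refuted.
    Good : Route G → Set
    Good Z = (∀ {X} → X ∈ K → X ≢ R → ¬ Z ≺ X × ¬ X ≺ Z) × ¬ Z ≺ R

    -- By completeness the splice of y and z would be a route of K inside the corner.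
    no-route-inside : ∀ {y z y₀ z₀} → Back w y → Fwd w z → Back w y₀ → Fwd w z₀ →
                      Good (y ʳ++ z₀) → Good (y₀ ʳ++ z) → ¬ y <ᵢ p → y <ᵢ p′ → q <ₒ z → ¬ q′ <ₒ z →
                      ¬ (p <ᵢ y × z <ₒ q′) → y ʳ++ z ≢ R → ⊥
    no-route-inside {y} {z} by fz by₀ fz₀ (gA , ¬A≺R) (gB , ¬B≺R) y≮p y<p′ q<z q′≮z ¬in ≢R = outside atY ≢R y<p′ q<z
      where
      Y : Route G
      Y = y ʳ++ z
      ¬Y≺ : ∀ {X} → X ∈ K → ¬ Y ≺ X
      ¬Y≺ {X} X∈ l with locate by fz l | X ≟ₗ R
      ... | inj₁ pre | yes refl = ¬A≺R (pre⇒≺ pre fz₀)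
      ... | inj₁ pre | no X≢ = proj₁ (gA X∈ X≢) (pre⇒≺ pre fz₀)
      ... | inj₂ (inj₁ post) | yes refl = ¬B≺R (post⇒≺ post by₀)
      ... | inj₂ (inj₁ post) | no X≢ = proj₁ (gB X∈ X≢) (post⇒≺ post by₀)
      ... | inj₂ (inj₂ (meet {x} {z′} X≡ bx _ y<x z′<z)) | _ = coh at₀ (met X∈ X≡ bx) p<x z′<q′
        where
        p<x : p <ᵢ x
        p<x with cmpᵢ by bp
        ... | inj₁ y<p = ⊥-elim (y≮p y<p)
        ... | inj₂ (inj₁ refl) = y<x
        ... | inj₂ (inj₂ p<y) = transᵢ p<y y<x
        z′<q′ : z′ <ₒ q′
        z′<q′ with cmpₒ fz fq′
        ... | inj₁ z<q′ = transₒ z′<z z<q′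
        ... | inj₂ (inj₁ refl) = z′<z
        ... | inj₂ (inj₂ q′<z) = ⊥-elim (q′≮z q′<z)
      ¬≺Y′ : ∀ {X} → X ∈ K → X ≢ R → ¬ X ≺ Y
      ¬≺Y′ X∈ X≢ l with Oᵒ.locate by fz (≺-op O l)
      ... | inj₁ pre = proj₂ (gA X∈ X≢) (≺-unop O (Oᵒ.pre⇒≺ pre fz₀))
      ... | inj₂ (inj₁ post) = proj₂ (gB X∈ X≢) (≺-unop O (Oᵒ.post⇒≺ post by₀))
      ... | inj₂ (inj₂ (Base.meet refl bx _ l l′)) =
              outside (met X∈ refl bx) X≢ (transᵢ (lex-flip l) y<p′) (transₒ q<z (lex-flip l′))
      ¬≺Y : ∀ {X} → X ∈ K → ¬ X ≺ Y
      ¬≺Y {X} X∈ l with X ≟ₗ R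
      ... | no X≢ = ¬≺Y′ X∈ X≢ l
      ... | yes refl with locate bp fq′ l
      ...   | inj₁ pre = ¬≺Y′ (mem at₁) P₁≢R (pre⇒≺ pre fq)
      ...   | inj₂ (inj₁ post) = ¬≺Y′ (mem at₂) P₂≢R (post⇒≺ post bp′)
      ...   | inj₂ (inj₂ (meet Y≡ bx _ l l′)) with split-unique by bx Y≡
      ...     | refl , refl = ¬in (l , l′)
      atY : At K w y z
      atY = at (complete (seg-path y by fz) λ X∈ → ¬Y≺ X∈ , ¬≺Y X∈) by fz

    flipped-max : Max flipped
    flipped-max = record { routes = routes′ ; coherent = coherent′ ; complete = complete′ }
      where
      routes′ : ∀ {X} → X ∈ flipped → IsRoute G X
      routes′ X∈ with unkept X∈
      ... | inj₁ refl = seg-path p′ bp′ fq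
      ... | inj₂ (X∈ , _) = routes X∈
      coherent′ : ∀ {X Y} → X ∈ flipped → Y ∈ flipped → ¬ X ≺ Y
      coherent′ X∈ Y∈ with unkept X∈ | unkept Y∈
      ... | inj₁ refl | inj₁ refl = ≺-irrefl
      ... | inj₁ refl | inj₂ (Y∈ , _) = ¬R′≺ Y∈
      ... | inj₂ (X∈ , X≢) | inj₁ refl = ¬≺R′ X∈ X≢
      ... | inj₂ (X∈ , _) | inj₂ (Y∈ , _) = coherent X∈ Y∈
      complete′ : ∀ {Y} → IsRoute G Y → (∀ {X} → X ∈ flipped → ¬ Y ≺ X × ¬ X ≺ Y) → Y ∈ flipped
      complete′ {Y} πY h with Y ≟ₗ R′
      ... | yes refl = here refl
      ... | no Y≢R′ = kept (complete πY coh′) λ { refl → proj₁ (h (here refl)) R≺R′ }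
        where
        h₁ : ¬ Y ≺ P₁ × ¬ P₁ ≺ Y
        h₁ = h (kept (mem at₁) P₁≢R)
        h₂ : ¬ Y ≺ P₂ × ¬ P₂ ≺ Y
        h₂ = h (kept (mem at₂) P₂≢R)
        ¬Y≺R : ¬ Y ≺ R
        ¬Y≺R l with Oᵒ.locate bp fq′ (≺-op O l)
        ... | inj₁ pre = proj₁ h₁ (≺-unop O (Oᵒ.pre⇒≺ pre fq))
        ... | inj₂ (inj₁ post) = proj₁ h₂ (≺-unop O (Oᵒ.post⇒≺ post bp′))
        ... | inj₂ (inj₂ (Base.meet Y≡ by fz l l′)) =
                proj₁ h₁ (conf Y≡ refl by fz bp fq (lex-flip l) (transₒ q<q′ (lex-flip l′)))
        goodY : Good Y
        goodY = (λ X∈ X≢ → h (kept X∈ X≢)) , ¬Y≺R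
        goodR : Good R
        goodR = (λ X∈ _ → coherent (mem at₀) X∈ , coherent X∈ (mem at₀)) , ≺-irrefl
        ¬R≺Y : ¬ R ≺ Y
        ¬R≺Y l with locate bp fq′ l
        ... | inj₁ pre = proj₂ h₁ (pre⇒≺ pre fq)
        ... | inj₂ (inj₁ post) = proj₂ h₂ (post⇒≺ post bp′)
        -- Coherence with `P₁`, `P₂` and `R′` pushes `(y , z)` onto one of the two sides of the
        -- rectangle that meet in `(p′ , q)`. Projected to the opposite side, as `(y , q′)` or
        -- `(p , z)`, it would be a forbidden pair of `K`.
        ... | inj₂ (inj₂ (meet {y} {z} refl by fz p<y z<q′)) with cmpᵢ by bp′ | cmpₒ fz fq
        ...   | inj₂ (inj₂ p′<y) | _ = proj₂ h₂ (conf refl refl bp′ fq′ by fz p′<y z<q′)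
        ...   | _ | inj₁ z<q = proj₂ h₁ (conf refl refl bp fq by fz p<y z<q)
        ...   | inj₂ (inj₁ refl) | inj₂ (inj₁ refl) = Y≢R′ refl
        ...   | inj₁ y<p′ | inj₂ (inj₂ q<z) = proj₁ (h (here refl)) (conf refl refl by fz bp′ fq y<p′ q<z)
        ...   | inj₁ y<p′ | inj₂ (inj₁ refl) =
                  no-route-inside by fq′ bp fz goodY goodR (λ y<p → irrᵢ (transᵢ p<y y<p)) y<p′ q<q′ irrₒ
                    (irrₒ ∘ proj₂) λ eq → case split-unique by bp eq of λ { (refl , _) → irrᵢ p<y }
        ...   | inj₂ (inj₁ refl) | inj₂ (inj₂ q<z) =
                  no-route-inside bp fz by fq′ goodR goodY irrᵢ p<p′ q<z (λ q′<z → irrₒ (transₒ z<q′ q′<z))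
                    (irrᵢ ∘ proj₁) λ eq → case split-unique bp bp eq of λ { (_ , refl) → irrₒ z<q′ }
        coh′ : ∀ {X} → X ∈ K → ¬ Y ≺ X × ¬ X ≺ Y
        coh′ {X} X∈ with X ≟ₗ R
        ... | yes refl = ¬Y≺R , ¬R≺Y
        ... | no X≢ = h (kept X∈ X≢)

    -- A route above `R′` at `w` is above `R` by transitivity there; otherwise it is above `P₁` or
    -- `P₂`.
    flipped-above : ∀ {Y} → Any (_≺ Y) flipped → Any (_≺ Y) K
    flipped-above h with find h
    ... | X , X∈ , X≺Y with unkept X∈
    ...   | inj₂ (X∈ , _) = lose X∈ X≺Y
    ...   | inj₁ refl with locate bp′ fq X≺Y
    ...     | inj₁ pre = lose (mem at₂) (pre⇒≺ pre fq′)
    ...     | inj₂ (inj₁ post) = lose (mem at₁) (post⇒≺ post bp)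
    ...     | inj₂ (inj₂ (meet Y≡ by fz l l′)) =
                lose (mem at₀) (conf refl Y≡ bp fq′ by fz (transᵢ p<p′ l) (transₒ l′ q<q′))

    flipped-cw : ∀ {C′} → (∀ {X Y} → X ∈ C′ → Y ∈ K → ¬ X ≺ Y) →
                 (∀ {x z} → x ʳ++ z ∈ C′ → Back w x → Fwd w z → x <ᵢ p′ → ¬ q <ₒ z) →
                 ∀ {X Y} → X ∈ C′ → Y ∈ flipped → ¬ X ≺ Y
    flipped-cw cw out X∈ Y∈ l with unkept Y∈
    ... | inj₂ (Y∈ , _) = cw X∈ Y∈ l
    ... | inj₁ refl with Oᵒ.locate bp′ fq (≺-op O l)
    ...   | inj₁ pre = cw X∈ (mem at₂) (≺-unop O (Oᵒ.pre⇒≺ pre fq′))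
    ...   | inj₂ (inj₁ post) = cw X∈ (mem at₁) (≺-unop O (Oᵒ.post⇒≺ post bp))
    ...   | inj₂ (inj₂ (Base.meet refl bx fz l l′)) = out X∈ bx fz (lex-flip l) (lex-flip l′)

  -- Finding a corner that may be flipped

  Prefix : List (Route G) → List E → Set
  Prefix K p = ∃ λ q → p ʳ++ q ∈ K

  abstract
    prefix? : ∀ K p → Dec (Prefix K p)
    prefix? K p = map′ to (λ (q , i) → lose (pairs⁺ i) refl) (any? (λ (x , _) → x ≟ₗ p) (pairs K))
      where
      to : Any (λ (x , _) → x ≡ p) (pairs K) → Prefix K p
      to h with find h
      ... | (_ , q) , i , refl = q , pairs⁻ i

  -- Candidates are the first edges at which a route of C leaves the prefixes of C′. The
  -- corner is taken at a candidate with first the vertex, then p minimal, then q maximal.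
  module Search (O : Orders) (C C′ : List (Route G)) (mC : Base.Max O C) (mC′ : Base.Max O C′) (cw : ∀ {X Y} → X ∈ C′ → Y ∈ C → ¬ Base._≺_ O X Y) where
    open Base O
    module C = Chain O C mC
    module Cᵒ = Chain (op O) C (max-op O mC)
    module C′ = Chain O C′ mC′
    module Oᵒ = Base (op O)

    cw-at : ∀ {w x z p q} → At C′ w x z → At C w p q → x <ᵢ p → ¬ q <ₒ z
    cw-at a b l l′ = cw (mem a) (mem b) (conf refl refl (back a) (fwd a) (back b) (fwd b) l l′)

    Candidate : List E × List E → Set
    Candidate (p , q) = ∃₂ λ e q₁ → q ≡ e ∷ q₁ × ¬ Prefix C′ (e ∷ p)

    candidate? : Decidable Candidate
    candidate? (p , []) = no λ ()
    candidate? (p , e ∷ q) = map′ (λ h → e , q , refl , h) (λ { (_ , _ , refl , h) → h }) (¬? (prefix? C′ (e ∷ p)))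

    record FlippableCorner : Set where
      field
        {w} : V
        {p q p′ q′} : List E
        corner : Corner O C w p q p′ q′
        outside : ∀ {x z} → x ʳ++ z ∈ C′ → Back w x → Fwd w z → x <ᵢ p′ → ¬ q <ₒ z

    module _ {w p e′ q₁} (at₀ : At C w p (e′ ∷ q₁)) (leaves : ¬ Prefix C′ (e′ ∷ p)) (min-w : ∀ {v x z} → At C v x z → Candidate (x , z) → ¬ v Fin.< w) (min-p : ∀ {x z} → At C w x z → Candidate (x , z) → ¬ (x <ᵢ p ⊎ (p ≡ x × e′ ∷ q₁ <ₒ z))) where

      q′ : List E
      q′ = e′ ∷ q₁

      tail-e′ : tail G e′ ≡ w
      tail-e′ with fwd at₀
      ... | cons h _ = h

      at′ : ∀ {v x} → Back v x → Prefix C′ x → ∃ λ z → At C′ v x z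
      at′ bx (z , i) = z , C′.at-route i bx

      earlier : ∀ {v x g z} → At C v x (g ∷ z) → v Fin.< w → Prefix C′ (g ∷ x)
      earlier {x = x} {g} a v<w with prefix? C′ (g ∷ x)
      ... | yes h = h
      ... | no h = ⊥-elim (min-w a (_ , _ , refl , h) v<w)

      used′ : ∃₂ λ y z → At C′ w y (e′ ∷ z)
      used′ with C′.edge-used e′
      ... | y , z , a = y , z , subst (λ v → At C′ v y (e′ ∷ z)) tail-e′ a

      p-prefix : Prefix C′ p
      p-prefix = go (back at₀) (mem at₀)
        where
        go : ∀ {p} → Back w p → p ʳ++ q′ ∈ C → Prefix C′ p
        go nil _ = _ , mem (proj₂ (proj₂ used′))
        go (snoc {g} b refl refl) i = earlier (C.at-route i b) (tail<head G g)

      -- The last edge `f` is used somewhere in `C`, and `extend` carries it over to `x₀`: an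
      -- obstructing pair of `C` lies before `w`, so its prefix and next edge occur in `C′`, where
      -- they would clash with `x₀` followed by `f`.
      prefix-back : ∀ {v x} → Back v x → v Fin.≤ w → Prefix C′ x → Prefix C x
      prefix-back nil _ _ = _ , mem at₀
      prefix-back (snoc {f} {x₀} bx refl refl) v≤w (z , i)
        with prefix-back bx (ℕ.<⇒≤ (ℕ.<-≤-trans (tail<head G f) v≤w)) (_ , i) | C.edge-used f
      ... | z₀ , i₀ | y , z₁ , b with cmpᵢ (back b) bx
      ...   | inj₂ (inj₁ refl) = _ , mem b
      ...   | inj₁ y<x₀ = let q , c = C.extend (C.at-route i₀ bx) b y<x₀ clear in q , mem c
        where
        clear : ∀ {x g z} → At C (tail G f) x (g ∷ z) → x <ᵢ x₀ → ¬ RO f g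
        clear a x<x₀ f<g with earlier a (ℕ.<-≤-trans (tail<head G f) v≤w)
        ... | _ , j = C′.coh (C′.at-route j (back a)) (C′.at-route i bx) x<x₀ (this f<g)
      ...   | inj₂ (inj₂ x₀<y) = let q , c = Cᵒ.extend (C.at-route i₀ bx) b (lex-flip x₀<y) clear in q , mem c
        where
        clear : ∀ {x g z} → At C (tail G f) x (g ∷ z) → x Oᵒ.<ᵢ x₀ → ¬ RO g f
        clear a x₀<x g<f with earlier a (ℕ.<-≤-trans (tail<head G f) v≤w)
        ... | _ , j = C′.coh (C′.at-route i bx) (C′.at-route j (back a)) (lex-flip x₀<x) (this g<f)

      -- If `y` were below `p`, `extend` in `C′` would carry `e′` over to `p`, contradicting
      -- `leaves`; an obstruction would put a route of `C′` cw below the route `p ʳ++ q′` of `C`.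
      p<used : ∀ {y z} → At C′ w y (e′ ∷ z) → p <ᵢ y
      p<used {y} a with cmpᵢ (back at₀) (back a)
      ... | inj₁ l = l
      ... | inj₂ (inj₁ refl) = ⊥-elim (leaves (_ , mem a))
      ... | inj₂ (inj₂ y<p) = ⊥-elim (leaves (_ , mem (proj₂ (C′.extend (proj₂ (at′ (back at₀) p-prefix)) a y<p clear))))
        where
        clear : ∀ {x g z} → At C′ w x (g ∷ z) → x <ᵢ p → ¬ RO e′ g
        clear b x<p e′<g = cw-at b at₀ x<p (this e′<g)

      -- A greater edge after `p` would clash, within `C′`, with the prefix above `p` that continues
      -- with `e′`.
      <e′ : ∀ {f z} → At C′ w p (f ∷ z) → RO f e′
      <e′ a with fwd a
      ... | cons h _ with RO-cmp (trans h (sym tail-e′))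
      ...   | inj₁ l = l
      ...   | inj₂ (inj₁ refl) = ⊥-elim (leaves (_ , mem a))
      ...   | inj₂ (inj₂ e′<f) with used′
      ...     | y , _ , b = ⊥-elim (C′.coh a b (p<used b) (this e′<f))

      p-edge : ∃₂ λ f z → At C′ w p (f ∷ z)
      p-edge with at′ (back at₀) p-prefix
      ... | f ∷ z , a = f , z , a
      ... | [] , a with fwd a
      ...   | nil = ⊥-elim (t-sink G e′ tail-e′)

      -- A successor exists because `prefix-back` brings a greater prefix from `C′` to `C`. If it
      -- kept `p`, it would be a candidate with a greater out-part, by `<e′` when the first edge
      -- differs from `e′`.
      upper : ∃ λ p′ → At C w p′ q′ × p <ᵢ p′ × (∀ {x z} → At C w x z → (p , q′) C.<ₗ (x , z) → ¬ (x , z) C.<ₗ (p′ , q′))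
      upper with used′
      ... | y , _ , b with prefix-back (back b) ℕ.≤-refl (_ , mem b)
      ...   | _ , i with C.successor at₀ (C.at-route i (back b)) (inj₁ (p<used b))
      ...     | C.succ a (inj₂ (p<p′ , refl)) none = _ , a , p<p′ , none
      ...     | C.succ a (inj₁ (refl , this l)) _ =
                  ⊥-elim (min-p a (_ , _ , refl , λ (_ , j) → RO-irrefl (RO-trans l (<e′ (C′.at-route j (back a))))) (inj₂ (refl , this l)))
      ...     | C.succ a (inj₁ (refl , next l)) _ = ⊥-elim (min-p a (_ , _ , refl , leaves) (inj₂ (refl , next l)))

      -- The edge that `C′` takes after `p` precedes `e′` and is used in `C`, so there is a
      -- predecessor. If it kept `q′`, it would be a candidate with a smaller prefix, by `p<used`.
      lower : ∃ λ q → At C w p q × q <ₒ q′ × (∀ {x z} → At C w x z → (p , q′) Cᵒ.<ₗ (x , z) → ¬ (x , z) Cᵒ.<ₗ (p , q))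
      lower with p-edge
      ... | f , z , a with C.edge-used f | fwd a
      ...   | y , z₁ , b | cons refl _ with Cᵒ.successor at₀ b before
        where
        before : (p , q′) Cᵒ.<ₗ (y , f ∷ z₁)
        before with cmpᵢ (back b) (back at₀)
        ... | inj₁ y<p = inj₁ (lex-flip y<p)
        ... | inj₂ (inj₁ refl) = inj₂ (refl , this (<e′ a))
        ... | inj₂ (inj₂ p<y) = ⊥-elim (C.coh at₀ b p<y (this (<e′ a)))
      ...     | C.succ c (inj₁ (refl , l)) none = _ , c , lex-flip l , none
      ...     | C.succ {p′ = p₁} c (inj₂ (p₁<p , refl)) _ with prefix? C′ (e′ ∷ p₁)
      ...       | yes (_ , i) = ⊥-elim (irrᵢ (transᵢ (p<used (C′.at-route i (back c))) (lex-flip p₁<p)))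
      ...       | no h = ⊥-elim (min-p c (_ , _ , refl , h) (inj₁ (lex-flip p₁<p)))

      module _ {q p′} (corner : Corner O C w p q p′ q′) where
        open Corner corner hiding (at₀)

        -- The routes p q and p z part after a common edge, at a vertex where the successor
        -- of p q in C clashes with the successor p″ z in C′ or with the corner.
        no-bad : ∀ {z} → At C′ w p z → ¬ q <ₒ z
        no-bad a q<z with C′.greatest {λ (x , z) → x ≡ p × q <ₒ z} (λ (x , z) → (x ≟ₗ p) ×-dec (q <ₒ? z)) w a (refl , q<z)
        ... | _ , z , a , (refl , q<z) , max with used′
        ...   | _ , _ , b with C′.successor a b (inj₁ (p<used b))
        ...     | C.succ c (inj₁ (refl , z<z₂)) _ = max c (refl , transₒ q<z z<z₂) (inj₂ (refl , z<z₂))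
        ...     | C.succ {p″} c (inj₂ (p<p″ , refl)) _ with fwd a | q<z
        ...       | cons {e = f} refl _ | this g<f with C.edge-used f
        ...         | y , _ , d with cmpᵢ (back d) (back at₀)
        ...           | inj₁ y<p = C.coh d at₁ y<p (this g<f)
        ...           | inj₂ (inj₂ p<y) = C.coh at₀ d p<y (this (<e′ a))
        ...           | inj₂ (inj₁ refl) with gapₒ d
        ...             | inj₁ refl = RO-irrefl (<e′ a)
        ...             | inj₂ h = h (this g<f)
        no-bad _ _ | _ , z , a , (refl , q<z) , max | _ , _ , b | C.succ {p″} c (inj₂ (p<p″ , refl)) _
          | cons {e = f} refl fz | next l with lex-common l
        ... | r , g , q₃ , h , z₃ , refl , refl , g<h with path-split r fz
        ...   | v , σ , cons refl _ with C.edge-used h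
        ...     | y , _ , d with C.successor at₁′ d after
          where
          p̂ : List E
          p̂ = r ++ f ∷ p
          at₁′ : At C (tail G h) p̂ (g ∷ q₃)
          at₁′ = C.at-route (subst (_∈ C) (sym (++-ʳ++ r)) (mem at₁)) (seg-++ r σ (snoc (back at₀) refl refl))
          after : (p̂ , g ∷ q₃) C.<ₗ (y , h ∷ _)
          after with cmpᵢ (back at₁′) (back d)
          ... | inj₁ l = inj₁ l
          ... | inj₂ (inj₁ e) = inj₂ (e , this g<h)
          ... | inj₂ (inj₂ l) = ⊥-elim (C.coh d at₁′ l (this g<h))
        ...       | C.succ {q′ = zₙ} k (inj₁ (refl , l′)) _
                  with gapₒ (C.at-route {p = p} {q = f ∷ r ʳ++ zₙ} (subst (_∈ C) (++-ʳ++ r) (mem k)) (back at₀))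
        ...         | inj₁ refl = RO-irrefl (<e′ a)
        ...         | inj₂ h = h (next (lex-ʳ++ r l′))
        no-bad _ _ | _ , z , a , (refl , q<z) , max | _ , _ , b | C.succ {p″} c (inj₂ (p<p″ , refl)) _
          | cons {e = f} refl fz | next l | r , g , q₃ , h , z₃ , refl , refl , g<h
          | v , σ , cons refl _ | y , _ , d | C.succ {n} k (inj₂ (p̂<n , refl)) _ = clash (cmpᵢ (back k) (back c′))
          where
          c′ : At C′ (tail G h) (r ++ f ∷ p″) (h ∷ z₃)
          c′ = C′.at-route (subst (_∈ C′) (sym (++-ʳ++ r)) (mem c)) (seg-++ r σ (snoc (back c) refl refl))
          -- Back at `w`, the successor would give the pair `(n₂ , q)` of `C`, which clashes with
          -- `(p , q′)`.
          through : ∀ {n₂} → n ≡ r ++ f ∷ n₂ → ¬ p <ᵢ n₂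
          through refl p<n₂ with seg-++⁻ r (back k)
          ... | _ , _ , snoc b refl refl =
                  C.coh at₀ (C.at-route (subst (_∈ C) (++-ʳ++ r) (mem k)) b) p<n₂ q<q′
          clash : n <ᵢ r ++ f ∷ p″ ⊎ n ≡ r ++ f ∷ p″ ⊎ r ++ f ∷ p″ <ᵢ n → ⊥
          clash (inj₂ (inj₂ l)) = cw-at c′ k l (this g<h)
          clash (inj₂ (inj₁ e)) = through e p<p″
          clash (inj₁ l) with lex-between RI-irrefl RI-trans r p̂<n l
          ... | _ , refl , l₁ , l₂ with lex-between RI-irrefl RI-trans (f ∷ []) l₁ l₂
          ...   | _ , refl , l₃ , _ = through refl l₃

        no-bad-route : ∀ {x z} → x ʳ++ z ∈ C′ → Back w x → Fwd w z → x <ᵢ p′ → ¬ q <ₒ z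
        no-bad-route i bx fz x<p′ q<z with cmpᵢ bx (back at₀)
        ... | inj₁ x<p = cw-at (at i bx fz) at₁ x<p q<z
        ... | inj₂ (inj₁ refl) = no-bad (at i bx fz) q<z
        ... | inj₂ (inj₂ p<x) = gapᵢ (C.at-route (proj₂ (prefix-back bx ℕ.≤-refl (_ , i))) bx) p<x x<p′

      flippable : FlippableCorner
      flippable with upper | lower
      ... | p′ , at₂ , p<p′ , none₂ | q , at₁ , q<q′ , none₁ = record { corner = corner ; outside = no-bad-route corner }
        where
        corner : Corner O C w p q p′ q′
        corner = record
          { at₁ = at₁ ; at₀ = at₀ ; at₂ = at₂ ; p<p′ = p<p′ ; q<q′ = q<q′
          ; gapᵢ = λ a p<x x<p′ → none₂ a (inj₁ p<x) (inj₁ x<p′)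
          ; gapₒ = gapₒ }
          where
          gapₒ : ∀ {z} → At C w p z → z ≡ q′ ⊎ ¬ q <ₒ z
          gapₒ a with cmpₒ (fwd a) (fwd at₀)
          ... | inj₂ (inj₁ e) = inj₁ e
          ... | inj₁ z<q′ = inj₂ λ q<z → none₁ a (inj₂ (refl , lex-flip z<q′)) (inj₂ (refl , lex-flip q<z))
          ... | inj₂ (inj₂ q′<z) = ⊥-elim (none₂ a (inj₂ (refl , q′<z)) (inj₁ p<p′))

    end : List E → V
    end [] = s G
    end (e ∷ _) = head G e

    end≡ : ∀ {v p} → Back v p → end p ≡ v
    end≡ nil = refl
    end≡ (snoc _ _ h) = h

    back-end : ∀ {p q} → p ʳ++ q ∈ C → Back (end p) p
    back-end {p} i with path-split p (C.routes i)
    ... | _ , b , _ = subst (λ v → Back v p) (sym (end≡ b)) b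

    -- Follow `R` while its prefixes occur in `C′`; at the sink this would put `R` in `C′`. The
    -- start is safe since an empty `C′` would, by completeness, contain `R`.
    exit : ∀ {R} → R ∈ C → ¬ R ∈ C′ → ∃₂ λ p q → p ʳ++ q ∈ C × Candidate (p , q)
    exit {R} R∈ R∉ = go [] R R∈ R∉ nonempty
      where
      nonempty : Prefix C′ []
      nonempty = some C′ R∉ λ ∅ → C′.complete (C.routes R∈) λ X∈ → ⊥-elim (∅ X∈)
        where
        some : ∀ K → ¬ R ∈ K → ((∀ {X} → ¬ X ∈ K) → R ∈ K) → Prefix K []
        some [] ∉ h = ⊥-elim (∉ (h λ ()))
        some (X ∷ _) _ _ = X , here refl
      go : ∀ p q → p ʳ++ q ∈ C → ¬ p ʳ++ q ∈ C′ → Prefix C′ p → ∃₂ λ p q → p ʳ++ q ∈ C × Candidate (p , q)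
      go p [] i ∉ (z , j) with path-split p (C.routes i) | path-split p (C′.routes j)
      ... | v , b , nil | _ , b′ , fz with seg-end b′ b
      ...   | refl with fwd-sink fz
      ...     | refl = ⊥-elim (∉ j)
      go p (e ∷ q) i ∉ _ with prefix? C′ (e ∷ p)
      ... | yes h = go (e ∷ p) q i ∉ h
      ... | no h = p , e ∷ q , i , e , q , refl , h

    flippable-corner : ∀ {R} → R ∈ C → ¬ R ∈ C′ → FlippableCorner
    flippable-corner R∈ R∉ with exit R∈ R∉
    ... | p , q , i , cand
      with extremal {_⊏_ = λ (p , _) (x , _) → end x Fin.< end p} (λ (p , _) (x , _) → end x Fin.<? end p)
             (λ l l′ → Fin.<-trans l′ l) (Fin.<-irrefl refl) {P = Candidate} candidate? (pairs C) (pairs⁺ {p = p} {q} i) cand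
    ... | (p₁ , q₁) , i₁ , cand₁ , min-end
      with C.extremal-at {P = Candidate} candidate? (end p₁) (λ (p , q) (x , z) → (x <ᵢ? p) ⊎-dec ((p ≟ₗ x) ×-dec (q <ₒ? z)))
             ⊏-trans ⊏-irrefl (C.at-route {p = p₁} {q₁} (pairs⁻ i₁) (back-end {p₁} {q₁} (pairs⁻ i₁))) cand₁
      where
      _⊏_ : Rel (List E × List E) 0ℓ
      (p , q) ⊏ (x , z) = x <ᵢ p ⊎ (p ≡ x × q <ₒ z)
      ⊏-trans : Transitive _⊏_
      ⊏-trans (inj₁ l) (inj₁ l′) = inj₁ (transᵢ l′ l)
      ⊏-trans (inj₁ l) (inj₂ (refl , _)) = inj₁ l
      ⊏-trans (inj₂ (refl , _)) (inj₁ l) = inj₁ l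
      ⊏-trans (inj₂ (refl , l)) (inj₂ (refl , l′)) = inj₂ (refl , transₒ l l′)
      ⊏-irrefl : ∀ {a} → ¬ a ⊏ a
      ⊏-irrefl (inj₁ l) = irrᵢ l
      ⊏-irrefl (inj₂ (_ , l)) = irrₒ l
    ... | p₂ , _ , a , (_ , _ , refl , leaves) , min =
            flippable a leaves
              (λ {_} {x} {z} b cand l → min-end (pairs⁺ {p = x} {z} (mem b)) cand (subst (Fin._< end p₁) (sym (end≡ (back b))) l)) min

  -- Translation to the given definitions and the two directions

  module Bridge (F : Framing G) where

    -- A framing orders only edges at a common vertex. Building the common head or tail into the
    -- relations makes them irreflexive and transitive on all edges.
    orders : Orders
    orders = record
      { RI = RI ; RO = RO
      ; RI-irrefl = λ {a} (_ , l) → IsStrictTotalOrder.irrefl (inSTO F (head G a)) {a , refl} {a , refl} refl l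
      ; RO-irrefl = λ {a} (_ , l) → IsStrictTotalOrder.irrefl (outSTO F (tail G a)) {a , refl} {a , refl} refl l
      ; RI-trans = RI-trans ; RO-trans = RO-trans
      ; RI-cmp = RI-cmp ; RO-cmp = RO-cmp
      ; RI? = RI? ; RO? = RO?
      }
      where
      RI RO : Rel E 0ℓ
      RI a b = head G b ≡ head G a × inLt F (head G a) a b
      RO a b = tail G b ≡ tail G a × outLt F (tail G a) a b
      RI-trans : Transitive RI
      RI-trans {a} {b} {c} (h , l) (h′ , l′) =
        trans h′ h , IsStrictTotalOrder.trans (inSTO F (head G a)) {a , refl} {b , h} {c , trans h′ h} l
                       (subst (λ v → inLt F v b c) h l′)
      RO-trans : Transitive RO
      RO-trans {a} {b} {c} (h , l) (h′ , l′) =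
        trans h′ h , IsStrictTotalOrder.trans (outSTO F (tail G a)) {a , refl} {b , h} {c , trans h′ h} l
                       (subst (λ v → outLt F v b c) h l′)
      RI-cmp : ∀ {a b} → head G a ≡ head G b → RI a b ⊎ a ≡ b ⊎ RI b a
      RI-cmp {a} {b} h with IsStrictTotalOrder.compare (inSTO F (head G a)) (a , refl) (b , sym h)
      ... | tri< l _ _ = inj₁ (sym h , l)
      ... | tri≈ _ e _ = inj₂ (inj₁ e)
      ... | tri> _ _ l = inj₂ (inj₂ (h , subst (λ v → inLt F v b a) h l))
      RO-cmp : ∀ {a b} → tail G a ≡ tail G b → RO a b ⊎ a ≡ b ⊎ RO b a
      RO-cmp {a} {b} h with IsStrictTotalOrder.compare (outSTO F (tail G a)) (a , refl) (b , sym h)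
      ... | tri< l _ _ = inj₁ (sym h , l)
      ... | tri≈ _ e _ = inj₂ (inj₁ e)
      ... | tri> _ _ l = inj₂ (inj₂ (h , subst (λ v → outLt F v b a) h l))
      RI? : ∀ a b → Dec (RI a b)
      RI? a b with head G b Fin.≟ head G a
      ... | no h = no (h ∘ proj₁)
      ... | yes h = map′ (h ,_) proj₂ (IsStrictTotalOrder._<?_ (inSTO F (head G a)) (a , refl) (b , h))
      RO? : ∀ a b → Dec (RO a b)
      RO? a b with tail G b Fin.≟ tail G a
      ... | no h = no (h ∘ proj₁)
      ... | yes h = map′ (h ,_) proj₂ (IsStrictTotalOrder._<?_ (outSTO F (tail G a)) (a , refl) (b , h))

    open Base orders

    revLtIn⇒<ᵢ : ∀ {v p x} → Back v p → Back v x → revLtIn G F p x → p <ᵢ x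
    revLtIn⇒<ᵢ (snoc {a} bp refl refl) (snoc {b} bx h h′) l with a Fin.≟ b
    revLtIn⇒<ᵢ (snoc bp refl refl) (snoc bx refl _) l | yes refl = next (revLtIn⇒<ᵢ bp bx l)
    ... | no _ = this (h′ , l)

    <ᵢ⇒revLtIn : ∀ {p x} → p <ᵢ x → revLtIn G F p x
    <ᵢ⇒revLtIn (this {a} {b} r) with a Fin.≟ b
    ... | yes refl = ⊥-elim (RI-irrefl r)
    ... | no _ = proj₂ r
    <ᵢ⇒revLtIn (next {a} l) with a Fin.≟ a
    ... | yes _ = <ᵢ⇒revLtIn l
    ... | no a≢a = ⊥-elim (a≢a refl)

    ltO⇒<ₒ : ∀ {v q z} → Fwd v q → Fwd v z → ltO G F q z → q <ₒ z
    ltO⇒<ₒ (cons {e = a} refl fq) (cons {e = b} h fz) l with a Fin.≟ b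
    ... | yes refl = next (ltO⇒<ₒ fq fz l)
    ... | no _ = this (h , l)

    <ₒ⇒ltO : ∀ {q z} → q <ₒ z → ltO G F q z
    <ₒ⇒ltO (this {a} {b} r) with a Fin.≟ b
    ... | yes refl = ⊥-elim (RO-irrefl r)
    ... | no _ = proj₂ r
    <ₒ⇒ltO (next {a} l) with a Fin.≟ a
    ... | yes _ = <ₒ⇒ltO l
    ... | no a≢a = ⊥-elim (a≢a refl)

    inner-split : ∀ {P v} → IsRoute G P → (i : InnerAt G P v) →
                  P ≡ reverse (upTo G i) ʳ++ from G i × Back v (reverse (upTo G i)) × Fwd v (from G i)
    inner-split {v = v} π (split pre post a b refl refl) =
      eq , bp , path-suffix p (subst (IsRoute G) eq π) bp
      where
      p : List E
      p = reverse (pre ++ a ∷ [])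
      eq : (pre ++ a ∷ []) ++ b ∷ post ≡ p ʳ++ (b ∷ post)
      eq = sym (trans (ʳ++-defn p) (cong (_++ b ∷ post) (reverse-involutive (pre ++ a ∷ []))))
      bp : Back v p
      bp with path-split p (subst (IsRoute G) eq π)
      ... | _ , σ , _ rewrite reverse-++ pre (a ∷ []) with σ
      ...   | snoc σ′ h _ = snoc σ′ h refl

    CW⇒≺ : ∀ {P v Q} → IsRoute G P → IsRoute G Q → CW G F P v Q → ∃ λ (c : P ≺ Q) → _≺_.v c ≡ v
    CW⇒≺ πP πQ (i , j , l , l′) with inner-split πP i | inner-split πQ j
    ... | P≡ , bp , fq | Q≡ , bx , fz = conf P≡ Q≡ bp fq bx fz (revLtIn⇒<ᵢ bp bx l) (ltO⇒<ₒ fz fq l′) , refl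

    inner : ∀ {P v a p b q} → P ≡ (a ∷ p) ʳ++ (b ∷ q) → Back v (a ∷ p) → InnerAt G P v
    inner {a = a} {p} {b} {q} P≡ (snoc _ _ h) =
      split (reverse p) q a b (trans P≡ (trans (ʳ++-defn (a ∷ p)) (cong (_++ b ∷ q) (unfold-reverse a p)))) h

    inner-back : ∀ {P v a p b q} (P≡ : P ≡ (a ∷ p) ʳ++ (b ∷ q)) (bp : Back v (a ∷ p)) →
                 reverse (upTo G (inner P≡ bp)) ≡ a ∷ p
    inner-back {a = a} {p} _ (snoc _ _ _) = trans (cong reverse (sym (unfold-reverse a p))) (reverse-involutive (a ∷ p))

    inner-fwd : ∀ {P v a p b q} (P≡ : P ≡ (a ∷ p) ʳ++ (b ∷ q)) (bp : Back v (a ∷ p)) → from G (inner P≡ bp) ≡ b ∷ q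
    inner-fwd _ (snoc _ _ _) = refl

    ≺-inner : ∀ {P Q} (c : P ≺ Q) → InnerAt G P (_≺_.v c) × InnerAt G Q (_≺_.v c)
    ≺-inner (conf {p = _ ∷ _} {_ ∷ _} {_ ∷ _} {_ ∷ _} P≡ Q≡ bp _ bx _ _ _) = inner P≡ bp , inner Q≡ bx

    ≺⇒CW : ∀ {P Q} (c : P ≺ Q) → CW G F P (_≺_.v c) Q
    ≺⇒CW (conf {p = _ ∷ _} {_ ∷ _} {_ ∷ _} {_ ∷ _} P≡ Q≡ bp _ bx _ l l′) =
      inner P≡ bp , inner Q≡ bx ,
      subst₂ (revLtIn G F) (sym (inner-back P≡ bp)) (sym (inner-back Q≡ bx)) (<ᵢ⇒revLtIn l) ,
      subst₂ (ltO G F) (sym (inner-fwd Q≡ bx)) (sym (inner-fwd P≡ bp)) (<ₒ⇒ltO l′)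

    fromMaxClique : ∀ {K} → MaxClique G F K → Max K
    fromMaxClique {K} ((routes , coherent) , maximal) = record
      { routes = All.lookup routes
      ; coherent = λ P∈ Q∈ c → proj₁ (coherent P∈ Q∈ _) (≺⇒CW c)
      ; complete = complete }
      where
      complete : ∀ {Y} → IsRoute G Y → (∀ {X} → X ∈ K → ¬ Y ≺ X × ¬ X ≺ Y) → Y ∈ K
      complete {Y} πY h = maximal (Y ∷ K) (πY ∷ routes , clique) there (here refl)
        where
        clique : ∀ {P Q} → P ∈ Y ∷ K → Q ∈ Y ∷ K → Coherent G F P Q
        clique (here refl) (here refl) v = self , self
          where
          self : ¬ CW G F Y v Y
          self c = ≺-irrefl (proj₁ (CW⇒≺ πY πY c))
        clique (here refl) (there Q∈) v =
          (λ c → proj₁ (h Q∈) (proj₁ (CW⇒≺ πY (All.lookup routes Q∈) c))) ,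
          (λ c → proj₂ (h Q∈) (proj₁ (CW⇒≺ (All.lookup routes Q∈) πY c)))
        clique (there P∈) (here refl) v =
          (λ c → proj₂ (h P∈) (proj₁ (CW⇒≺ (All.lookup routes P∈) πY c))) ,
          (λ c → proj₁ (h P∈) (proj₁ (CW⇒≺ πY (All.lookup routes P∈) c)))
        clique (there P∈) (there Q∈) = coherent P∈ Q∈

    toMaxClique : ∀ {K} → Max K → MaxClique G F K
    toMaxClique {K} mx =
      (All.tabulate routes , λ P∈ Q∈ v →
        (λ c → coherent P∈ Q∈ (proj₁ (CW⇒≺ (routes P∈) (routes Q∈) c))) ,
        (λ c → coherent Q∈ P∈ (proj₁ (CW⇒≺ (routes Q∈) (routes P∈) c)))) ,
      λ D (routesD , coherentD) K⊆D Y∈ → complete (All.lookup routesD Y∈) λ X∈ →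
        (λ c → proj₁ (coherentD Y∈ (K⊆D X∈) _) (≺⇒CW c)) ,
        (λ c → proj₁ (coherentD (K⊆D X∈) Y∈ _) (≺⇒CW c))
      where open Max mx

    -- Negative form of `CwFrom`: at one common vertex the two directions exclude each other, so
    -- forbidding one leaves exactly the permitted cases.
    Below : Rel (List (Route G)) 0ℓ
    Below C C′ = ∀ {X Y} → X ∈ C′ → Y ∈ C → ¬ X ≺ Y

    fromCwFrom : ∀ {C C′} → Max C → Max C′ → CwFrom G F C C′ → Below C C′
    fromCwFrom mC mC′ cw X∈ Y∈ c with ≺-inner c
    ... | iX , iY with cw Y∈ X∈ _ iY iX
    ...   | inj₁ coh = proj₂ coh (≺⇒CW c)
    ...   | inj₂ c′ with c | CW⇒≺ (Max.routes mC Y∈) (Max.routes mC′ X∈) c′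
    ...     | conf X≡ Y≡ bx _ by _ l _ | conf Y≡′ X≡′ by′ _ bx′ _ l′ _ , refl
              with split-unique bx bx′ (trans (sym X≡) X≡′) | split-unique by by′ (trans (sym Y≡) Y≡′)
    ...       | refl , _ | refl , _ = irrᵢ (transᵢ l l′)

    toCwFrom : ∀ {C C′} → Max C → Max C′ → Below C C′ → CwFrom G F C C′
    toCwFrom mC mC′ below {R} {X} R∈ X∈ v i j
      with inner-split πR i | inner-split πX j
      where
      πR = Max.routes mC R∈
      πX = Max.routes mC′ X∈
    ... | R≡ , bp , fq | X≡ , bx , fz with (reverse (upTo G i) <ᵢ? reverse (upTo G j)) ×-dec (from G j <ₒ? from G i)
    ...   | yes (l , l′) = inj₂ (≺⇒CW (conf R≡ X≡ bp fq bx fz l l′))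
    ...   | no ¬l = inj₁ (¬CW , λ c → below X∈ R∈ (proj₁ (CW⇒≺ (Max.routes mC′ X∈) (Max.routes mC R∈) c)))
      where
      ¬CW : ¬ CW G F R v X
      ¬CW c with CW⇒≺ (Max.routes mC R∈) (Max.routes mC′ X∈) c
      ... | conf R≡′ X≡′ bp′ _ bx′ _ l l′ , refl
        with split-unique bp bp′ (trans (sym R≡) R≡′) | split-unique bx bx′ (trans (sym X≡) X≡′)
      ...   | p≡ , q≡ | x≡ , z≡ = ¬l (subst₂ _<ᵢ_ (sym p≡) (sym x≡) l , subst₂ _<ₒ_ (sym z≡) (sym q≡) l′)

    ≤L⇒below : ∀ {C C′} → Max C → Max C′ → _≤L_ G F C C′ → Below C C′
    ≤L⇒below mC mC′ (≤-refl (C⊆C′ , _)) X∈ Y∈ = Max.coherent mC′ X∈ (C⊆C′ Y∈)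
    ≤L⇒below mC mC′ (≤-step {C} {D} (R , R′ , u , R∈ , πR′ , cw , C′≡) mD D≤) X∈ =
      swap-cw orders mC mD′ swap (proj₁ (CW⇒≺ (Max.routes mC R∈) πR′ cw)) (≤L⇒below mD′ mC′ D≤ X∈)
      where
      mD′ : Max D
      mD′ = fromMaxClique mD
      swap : Swap C D R R′
      swap = record
        { R∈ = R∈
        ; R′∈ = Equivalence.from (C′≡ R′) (inj₂ refl)
        ; C⇒D = λ X∈ X≢ → Equivalence.from (C′≡ _) (inj₁ (X∈ , X≢))
        ; D⇒C = λ X∈ X≢ → [ proj₁ , (λ e → ⊥-elim (X≢ e)) ] (Equivalence.to (C′≡ _) X∈)
        }

    routesWords : List (List E)
    routesWords = words (allFin (m G)) (n G)

    route∈words : ∀ {R} → IsRoute G R → R ∈ routesWords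
    route∈words π = ∈-words ∈-allFin _ (ℕ.≤-trans (ℕ.m+n≤o⇒n≤o _ (path-length π)) (ℕ.<⇒≤ (Fin.toℕ<n (t G))))

    above? : ∀ C → Decidable (λ Y → Any (_≺ Y) C)
    above? C Y = any? (_≺? Y) C

    -- An upward flip strictly shrinks the set of words above some route of the clique.
    height : List (Route G) → ℕ
    height C = length (filter (above? C) routesWords)

    below⇒≤L : ∀ {C C′} → Max C → Max C′ → Below C C′ → Acc ℕ._<_ (height C) → _≤L_ G F C C′
    below⇒≤L {C} {C′} mC mC′ below (acc rec) with any? (λ R → ¬? (R ∈? C′)) C
    ... | no all = ≤-refl (C⊆C′ , λ X∈ → Max.complete mC (Max.routes mC′ X∈) λ Y∈ →
                      Max.coherent mC′ X∈ (C⊆C′ Y∈) , Max.coherent mC′ (C⊆C′ Y∈) X∈)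
      where
      C⊆C′ : ∀ {X} → X ∈ C → X ∈ C′
      C⊆C′ X∈ = decidable-stable (_ ∈? C′) λ X∉ → all (lose X∈ X∉)
    ... | yes some with find some
    ...   | _ , R∈ , R∉ with Search.flippable-corner orders C C′ mC mC′ below R∈ R∉
    ...     | record { corner = corner ; outside = ¬bad } =
                ≤-step cover (toMaxClique flipped-max)
                  (below⇒≤L flipped-max mC′ (flipped-cw below ¬bad) (rec lower))
      where
      open Flip orders C mC corner
      πR′ : IsRoute G R′
      πR′ = Max.routes flipped-max (here refl)
      cover : Cover G F C flipped
      cover = R , R′ , _ , mem (Corner.at₀ corner) , πR′ , ≺⇒CW R≺R′ , λ X → mk⇔ to fro
        where
        to : ∀ {X} → X ∈ flipped → (X ∈ C × X ≢ R) ⊎ X ≡ R′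
        to X∈ = [ inj₂ , inj₁ ] (unkept X∈)
        fro : ∀ {X} → (X ∈ C × X ≢ R) ⊎ X ≡ R′ → X ∈ flipped
        fro (inj₁ (X∈ , X≢)) = kept X∈ X≢
        fro (inj₂ X≡) = here X≡
      lower : height flipped ℕ.< height C
      -- The word lost is `R′`: it is above `R`, but above no member of the flipped clique, to which
      -- it belongs.
      lower = length-filter-< (above? flipped) (above? C) flipped-above (route∈words πR′) (lose (mem (Corner.at₀ corner)) R≺R′)
                λ h → let X , X∈ , X≺R′ = find h in Max.coherent flipped-max X∈ (here refl) X≺R′

theorem2p15 : (G : FlowGraph) (F : Framing G) (C C' : List (Route G)) →
    MaxClique G F C → MaxClique G F C' →
    (_≤L_ G F C C' ⇔ CwFrom G F C C')
theorem2p15 G F C C' maxC maxC' = mk⇔ to fro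
  where
  open Paths G
  open Bridge F
  mC : Base.Max orders C
  mC = fromMaxClique maxC
  mC' : Base.Max orders C'
  mC' = fromMaxClique maxC'
  to : _≤L_ G F C C' → CwFrom G F C C'
  to C≤C' = toCwFrom mC mC' (≤L⇒below mC mC' C≤C')
  fro : CwFrom G F C C' → _≤L_ G F C C'
  fro cw = below⇒≤L mC mC' (fromCwFrom mC mC' cw) (<-wellFounded _)
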